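{- As formal power series in $q$ (equivalently, for complex $q$ with $|q|<1$), $$\sum_{n\ge 0}\frac{q^{n^2+n}}{(q;q)_{2n+1}}=\frac{1}{(q;q)_\infty}\sum_{k\in\mathbb{Z}}\left(q^{15k^2-4k}-q^{15k^2+14k+3}\right).$$
   Context: $(q;q)_n=\prod_{j=1}^{n}(1-q^j)$ and $(q;q)_\infty=\prod_{j\ge1}(1-q^j)$. -}

module Defs where

open import Data.Nat.Base as ℕ using (ℕ; zero; suc; _∸_; _≤_; _<_; z≤n; s≤s)
import Data.Nat.Properties as ℕ
open import Data.Integer.Base using (ℤ; +_; -[1+_]; 0ℤ; 1ℤ; -_; _+_; _*_; _-_; ∣_∣)
import Data.Integer.Properties as ℤ
open import Data.Integer.Tactic.RingSolver using (solve-∀)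
open import Data.Fin.Base using (Fin; zero; suc; toℕ)
import Data.Fin.Properties as Fin
open import Data.Vec.Functional using (Vector; []; _∷_)
open import Data.List.Base using (List; foldr; upTo; map; _++_)
open import Data.List.Membership.Propositional using (_∈_; _∉_)
open import Data.List.Membership.Propositional.Properties
  using (∈-upTo⁺; ∈-map⁺; ∈-map⁻; ∈-++⁺ˡ; ∈-++⁺ʳ)
open import Data.List.Relation.Unary.Unique.Propositional using (Unique)
import Data.List.Relation.Unary.Unique.Propositional.Properties as Unique
open import Data.Product.Base using (_,_)
open import Relation.Nullary.Negation.Core using (contradiction)
open import Relation.Nullary.Decidable.Core using (yes; no)
open import Relation.Binary.PropositionalEquality
open import Algebra.Properties.Semiring.Sum ℤ.+-*-semiring
  using (sum⁺-syntax; sum-cong-≗; sum-replicate-zero)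

------------------------------------------------------------------------
-- The ring ℤ[[q]]

-- A power series is its sequence of coefficients.
FPS : Set
FPS = ℕ → ℤ

infix  4 _≈_
infixl 6 _⊖_
infixl 7 _·_ _/_
infix  8 1/_
infix  9 q^_

_≈_ : FPS → FPS → Set
a ≈ b = ∀ N → a N ≡ b N

q^_ : ℕ → FPS
(q^ zero)  zero    = 1ℤ
(q^ zero)  (suc N) = 0ℤ
(q^ suc e) zero    = 0ℤ
(q^ suc e) (suc N) = (q^ e) N

1ₛ : FPS
1ₛ = q^ 0

_⊖_ : FPS → FPS → FPS
(a ⊖ b) N = a N - b N

_·_ : FPS → FPS → FPS
(a · b) N = ∑[ i ≤ N ] (a (toℕ i) * b (N ∸ toℕ i))

-- For a series a with constant coefficient 1, the coefficients b of 1/a are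
-- determined by b₀ = 1 and bₙ₊₁ = - (a₁ bₙ + … + aₙ₊₁ b₀).  The vector
-- 1/-prefix a n is bₙ₋₁ , … , b₀.
1/-prefix : FPS → ∀ n → Vector ℤ n
1/-prefix a zero          = []
1/-prefix a (suc zero)    = 1ℤ ∷ []
1/-prefix a (suc (suc n)) =
  (- (∑[ i ≤ n ] (a (suc (toℕ i)) * 1/-prefix a (suc n) i))) ∷ 1/-prefix a (suc n)

-- Meaningful only when the constant coefficient is 1; see 1/-inverseʳ.
1/_ : FPS → FPS
(1/ a) n = 1/-prefix a (suc n) zero

_/_ : FPS → FPS → FPS
a / b = a · (1/ b)

1/-prefix-coeff : ∀ a n (i : Fin (suc n)) →
                  1/-prefix a (suc n) i ≡ (1/ a) (n ∸ toℕ i)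
1/-prefix-coeff a n       zero    = refl
1/-prefix-coeff a (suc n) (suc i) = 1/-prefix-coeff a n i

1/-inverseʳ : ∀ a → a 0 ≡ 1ℤ → a · (1/ a) ≈ 1ₛ
1/-inverseʳ a a₀≡1 zero    rewrite a₀≡1 = refl
1/-inverseʳ a a₀≡1 (suc n) = begin
  a 0 * - s + t  ≡⟨ cong₂ (λ x y → x * - s + y) a₀≡1 t≡s ⟩
  1ℤ * - s + s   ≡⟨ cong (_+ s) (ℤ.*-identityˡ (- s)) ⟩
  - s + s        ≡⟨ ℤ.+-inverseˡ s ⟩
  0ℤ             ∎
  where
  open ≡-Reasoning
  s = ∑[ i ≤ n ] (a (suc (toℕ i)) * 1/-prefix a (suc n) i)
  t = ∑[ i ≤ n ] (a (suc (toℕ i)) * (1/ a) (n ∸ toℕ i))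
  t≡s : t ≡ s
  t≡s = sum-cong-≗ {suc n} λ i → cong (a (suc (toℕ i)) *_) (sym (1/-prefix-coeff a n i))

·-identityʳ : ∀ a → a · 1ₛ ≈ a
·-identityʳ a zero    = trans (ℤ.+-identityʳ _) (ℤ.*-identityʳ (a 0))
·-identityʳ a (suc N) = trans (cong₂ _+_ (ℤ.*-zeroʳ (a 0)) (·-identityʳ (λ n → a (suc n)) N))
                              (ℤ.+-identityˡ _)

q^-below : ∀ {e N} → N < e → (q^ e) N ≡ 0ℤ
q^-below {suc e} {zero}  _         = refl
q^-below {suc e} {suc N} (s≤s N<e) = q^-below N<e

q^·-below : ∀ {e} b {N} → N < e → (q^ e · b) N ≡ 0ℤ
q^·-below {e} b {N} N<e = trans
  (sum-cong-≗ {suc N} λ i → cong (_* b (N ∸ toℕ i))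
    (q^-below (ℕ.≤-<-trans (Fin.toℕ≤pred[n] i) N<e)))
  (sum-replicate-zero (suc N))

------------------------------------------------------------------------
-- Infinite sums and limits in ℤ[[q]]

-- A family is summable when each coefficient is nonzero for only finitely
-- many indices; its sum is then taken coefficientwise, and does not depend on
-- the choice of the finite sets of indices.
record Summable {I : Set} (f : I → FPS) : Set where
  field
    support  : ℕ → List I
    unique   : ∀ N → Unique (support N)
    vanishes : ∀ N i → i ∉ support N → f i N ≡ 0ℤ

∑ : {I : Set} (f : I → FPS) → Summable f → FPS
∑ f s N = foldr (λ i c → f i N + c) 0ℤ (Summable.support s N)

-- Convergence for the q-adic topology: each coefficient is eventually constant.
record Convergent (s : ℕ → FPS) : Set where
  field
    stage  : ℕ → ℕ
    stable : ∀ N n → stage N ≤ n → s n N ≡ s (stage N) N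

lim : (s : ℕ → FPS) → Convergent s → FPS
lim s c N = s (Convergent.stage c N) N

------------------------------------------------------------------------
-- (q;q)ₙ and (q;q)∞

qPoch : ℕ → FPS
qPoch zero    = 1ₛ
qPoch (suc n) = qPoch n · (1ₛ ⊖ q^ (suc n))

qPoch-step : ∀ {N n} → N ≤ n → qPoch (suc n) N ≡ qPoch n N
qPoch-step {N} {n} N≤n = trans
  (sum-cong-≗ {suc N} λ i → cong (qPoch n (toℕ i) *_) (trans
    (cong (λ x → 1ₛ (N ∸ toℕ i) - x)
      (q^-below (s≤s (ℕ.≤-trans (ℕ.m∸n≤m N (toℕ i)) N≤n))))
    (ℤ.+-identityʳ (1ₛ (N ∸ toℕ i)))))
  (·-identityʳ (qPoch n) N)

qPoch-stable : ∀ N n → N ≤ n → qPoch n N ≡ qPoch N N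
qPoch-stable zero    zero    z≤n = refl
qPoch-stable N       (suc n) N≤1+n with N ℕ.≟ suc n
... | yes refl  = refl
... | no  N≢1+n = trans (qPoch-step N≤n) (qPoch-stable N n N≤n)
  where N≤n = ℕ.≤-pred (ℕ.≤∧≢⇒< N≤1+n N≢1+n)

qPoch-convergent : Convergent qPoch
qPoch-convergent = record { stage = λ N → N ; stable = qPoch-stable }

qPoch∞ : FPS
qPoch∞ = lim qPoch qPoch-convergent

qPoch-constant : ∀ n → qPoch n 0 ≡ 1ℤ
qPoch-constant n = qPoch-stable 0 n z≤n

qPoch∞-constant : qPoch∞ 0 ≡ 1ℤ
qPoch∞-constant = refl

------------------------------------------------------------------------
-- The two series

lhsTerm : ℕ → FPS
lhsTerm n = q^ (n ℕ.^ 2 ℕ.+ n) / qPoch (2 ℕ.* n ℕ.+ 1)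

lhs-summable : Summable lhsTerm
lhs-summable = record
  { support  = λ N → upTo (suc N)
  ; unique   = λ N → Unique.upTo⁺ (suc N)
  ; vanishes = λ N n n∉ → q^·-below (1/ qPoch (2 ℕ.* n ℕ.+ 1))
      (ℕ.≤-trans (ℕ.≮⇒≥ λ n<1+N → n∉ (∈-upTo⁺ n<1+N)) (ℕ.m≤n+m n (n ℕ.^ 2)))
  }

e₁ e₂ : ℤ → ℤ
e₁ k = + 15 * (k * k) - + 4 * k
e₂ k = + 15 * (k * k) + + 14 * k + + 3

-- The exponents are nonnegative, so ∣_∣ merely converts them to ℕ; see
-- e₁-nonneg and e₂-nonneg.
rhsTerm : ℤ → FPS
rhsTerm k = q^ ∣ e₁ k ∣ ⊖ q^ ∣ e₂ k ∣

private
  quadratic : ∀ {x} a b c m → x ≡ + a * (+ m * + m) + + b * + m + + c →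
              x ≡ + (a ℕ.* (m ℕ.* m) ℕ.+ b ℕ.* m ℕ.+ c)
  quadratic a b c m eq = trans eq (sym (begin
    + (a ℕ.* (m ℕ.* m) ℕ.+ b ℕ.* m ℕ.+ c)
      ≡⟨ cong₂ (λ x y → x + y + + c)
           (trans (ℤ.pos-* a (m ℕ.* m)) (cong (+ a *_) (ℤ.pos-* m m))) (ℤ.pos-* b m) ⟩
    + a * (+ m * + m) + + b * + m + + c ∎))
    where open ≡-Reasoning

  e₁-pos : ∀ x → + 15 * ((1ℤ + x) * (1ℤ + x)) - + 4 * (1ℤ + x)
               ≡ + 15 * (x * x) + + 26 * x + + 11
  e₁-pos = solve-∀

  e₁-neg : ∀ x → + 15 * (- (1ℤ + x) * - (1ℤ + x)) - + 4 * - (1ℤ + x)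
               ≡ + 15 * (x * x) + + 34 * x + + 19
  e₁-neg = solve-∀

  e₂-neg : ∀ x → + 15 * (- (1ℤ + x) * - (1ℤ + x)) + + 14 * - (1ℤ + x) + + 3
               ≡ + 15 * (x * x) + + 16 * x + + 4
  e₂-neg = solve-∀

  e₁ℕ e₂ℕ : ℤ → ℕ
  e₁ℕ (+ zero)    = 0
  e₁ℕ (+ (suc m)) = 15 ℕ.* (m ℕ.* m) ℕ.+ 26 ℕ.* m ℕ.+ 11
  e₁ℕ -[1+ m ]    = 15 ℕ.* (m ℕ.* m) ℕ.+ 34 ℕ.* m ℕ.+ 19
  e₂ℕ (+ m)       = 15 ℕ.* (m ℕ.* m) ℕ.+ 14 ℕ.* m ℕ.+ 3
  e₂ℕ -[1+ m ]    = 15 ℕ.* (m ℕ.* m) ℕ.+ 16 ℕ.* m ℕ.+ 4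

  e₁≡ : ∀ k → e₁ k ≡ + e₁ℕ k
  e₁≡ (+ zero)    = refl
  e₁≡ (+ (suc m)) = quadratic 15 26 11 m (e₁-pos (+ m))
  e₁≡ -[1+ m ]    = quadratic 15 34 19 m (e₁-neg (+ m))

  e₂≡ : ∀ k → e₂ k ≡ + e₂ℕ k
  e₂≡ (+ m)    = quadratic 15 14 3 m refl
  e₂≡ -[1+ m ] = quadratic 15 16 4 m (e₂-neg (+ m))

  quadratic-≥ : ∀ a b c m → m ≤ a ℕ.+ suc b ℕ.* m ℕ.+ c
  quadratic-≥ a b c m = ℕ.≤-trans (ℕ.m≤m+n m (b ℕ.* m))
    (ℕ.≤-trans (ℕ.m≤n+m _ a) (ℕ.m≤m+n _ c))

  quadratic-> : ∀ a b c m → suc m ≤ a ℕ.+ suc b ℕ.* m ℕ.+ suc c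
  quadratic-> a b c m = subst (suc m ≤_) (sym (ℕ.+-suc (a ℕ.+ suc b ℕ.* m) c))
    (s≤s (quadratic-≥ a b c m))

  e₁ℕ-≥ : ∀ k → ∣ k ∣ ≤ e₁ℕ k
  e₁ℕ-≥ (+ zero)    = z≤n
  e₁ℕ-≥ (+ (suc m)) = quadratic-> (15 ℕ.* (m ℕ.* m)) 25 10 m
  e₁ℕ-≥ -[1+ m ]    = quadratic-> (15 ℕ.* (m ℕ.* m)) 33 18 m

  e₂ℕ-≥ : ∀ k → ∣ k ∣ ≤ e₂ℕ k
  e₂ℕ-≥ (+ m)    = quadratic-≥ (15 ℕ.* (m ℕ.* m)) 13 3 m
  e₂ℕ-≥ -[1+ m ] = quadratic-> (15 ℕ.* (m ℕ.* m)) 15 3 m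

e₁-nonneg : ∀ k → + ∣ e₁ k ∣ ≡ e₁ k
e₁-nonneg k rewrite e₁≡ k = refl

e₂-nonneg : ∀ k → + ∣ e₂ k ∣ ≡ e₂ k
e₂-nonneg k rewrite e₂≡ k = refl

e₁-≥ : ∀ k → ∣ k ∣ ≤ ∣ e₁ k ∣
e₁-≥ k rewrite e₁≡ k = e₁ℕ-≥ k

e₂-≥ : ∀ k → ∣ k ∣ ≤ ∣ e₂ k ∣
e₂-≥ k rewrite e₂≡ k = e₂ℕ-≥ k

-- The integers from -(1+N) to N.
ℤ-range : ℕ → List ℤ
ℤ-range N = map +_ (upTo (suc N)) ++ map -[1+_] (upTo (suc N))

ℤ-range-unique : ∀ N → Unique (ℤ-range N)
ℤ-range-unique N = Unique.++⁺
  (Unique.map⁺ ℤ.+-injective (Unique.upTo⁺ (suc N)))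
  (Unique.map⁺ ℤ.-[1+-injective (Unique.upTo⁺ (suc N)))
  λ (p , n) → disjoint (∈-map⁻ +_ p) (∈-map⁻ -[1+_] n)
  where
  open import Data.Empty using (⊥)
  open import Data.Product.Base using (∃; _×_)
  disjoint : ∀ {k} → ∃ (λ m → m ∈ upTo (suc N) × k ≡ + m) →
             ∃ (λ m → m ∈ upTo (suc N) × k ≡ -[1+ m ]) → ⊥
  disjoint (_ , _ , refl) (_ , _ , ())

∉-ℤ-range : ∀ N k → k ∉ ℤ-range N → N < ∣ k ∣
∉-ℤ-range N (+ m) k∉ =
  ℕ.≮⇒≥ λ m<1+N → k∉ (∈-++⁺ˡ (∈-map⁺ +_ (∈-upTo⁺ m<1+N)))
∉-ℤ-range N -[1+ m ] k∉ =
  ℕ.m≤n⇒m≤1+n (ℕ.≮⇒≥ λ m<1+N →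
    k∉ (∈-++⁺ʳ (map +_ (upTo (suc N))) (∈-map⁺ -[1+_] (∈-upTo⁺ m<1+N))))

rhs-summable : Summable rhsTerm
rhs-summable = record
  { support  = ℤ-range
  ; unique   = ℤ-range-unique
  ; vanishes = λ N k k∉ → let N<k = ∉-ℤ-range N k k∉ in
      cong₂ _-_ (q^-below (ℕ.<-≤-trans N<k (e₁-≥ k)))
                (q^-below (ℕ.<-≤-trans N<k (e₂-≥ k)))
  }

{-# OPTIONS --safe #-}

-- Put 1/(q;q)ₙ = 0 for n < 0, so that 1/(q;q)ₙ₋₁ = (1 - qⁿ)/(q;q)ₙ for every
-- integer n.  The polynomial identity
--   ∑ₖ q^(6k²-k) [2n+1; n+3k] - ∑ₖ q^(6k²+5k+1) [2n+1; n-3k-1] = 1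
-- between Gaussian binomials (the minimal model M(2,3)) and its analogue for
-- 2n in place of 2n+1 prove each other by the Pascal rules: in one direction
-- the remainders telescope in k, in the other they agree term by term.
-- It exhibits 1/(q;q)₂ₙ₊₁ as the β-side of a Bailey pair relative to q.  The
-- conjugate Bailey pair
--   ∑ₙ q^(n²+n) / ((q;q)ₙ₋ᵣ (q;q)ₙ₊ᵣ₊₁ (q;q)ₐ₋ₙ) = q^(r²+r) / ((q;q)ₐ₋ᵣ (q;q)ₐ₊ᵣ₊₁)
-- is the finite Durfee rectangle identity, proved by induction on a.  Together
-- they give a finite form of the theorem, in which a → ∞ modulo every power of
-- q leaves the theorem multiplied by 1/(q;q)∞.

module Submission where

open import Data.Nat.Base as ℕ using (ℕ; zero; suc; z≤n; s≤s; _∸_)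
import Data.Nat.Properties as ℕ
import Data.Nat.Tactic.RingSolver as ℕ-Solver
open import Data.Integer.Base as ℤ using (ℤ; +_; -[1+_]; 0ℤ; 1ℤ; ∣_∣)
import Data.Integer.Properties as ℤ
open import Data.Integer.Tactic.RingSolver using (solve-∀)
open import Data.Fin.Base using (toℕ)
import Data.Fin.Properties as Fin
open import Data.List.Base using (foldr; applyUpTo; upTo; map; _++_)
import Data.List.Properties as List
open import Data.Product.Base using (_,_)
open import Data.Sum.Base using (inj₁; inj₂)
open import Function.Base using (id)
open import Algebra.Bundles using (CommutativeRing)
open import Level using (0ℓ; _⊔_)
open import Relation.Binary.Structures using (IsEquivalence)
open import Relation.Binary.PropositionalEquality as ≡ using (_≡_; cong; cong₂)
import Algebra.Properties.Semiring.Sum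
import Algebra.Properties.Ring
import Algebra.Solver.Ring.NaturalCoefficients.Default
import Relation.Binary.Reasoning.Setoid

-- Finite and bilateral sums

module Summation {c ℓ} (R : CommutativeRing c ℓ) where
  open CommutativeRing R
  open Algebra.Properties.Semiring.Sum semiring
  open Algebra.Solver.Ring.NaturalCoefficients.Default commutativeSemiring
    using (solve; _:+_; _:=_)
  open Relation.Binary.Reasoning.Setoid setoid

  opaque
    -- Opaque, so that sums stay symbolic outside this block; even the recursion `∑<-suc` and the
    -- empty sum then have to be invoked as lemmas.
    ∑< : ℕ → (ℕ → Carrier) → Carrier
    ∑< n f = ∑[ i < n ] f (toℕ i)

    ∑<-suc : ∀ n f → ∑< (suc n) f ≈ f 0 + ∑< n (λ i → f (suc i))
    ∑<-suc n f = refl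

    ∑<-cong : ∀ n {f g} → (∀ i → i ℕ.< n → f i ≈ g i) → ∑< n f ≈ ∑< n g
    ∑<-cong n f≈g = sum-cong-≋ {n} λ i → f≈g (toℕ i) (Fin.toℕ<n i)

    ∑<-zero : ∀ n {f} → (∀ i → i ℕ.< n → f i ≈ 0#) → ∑< n f ≈ 0#
    ∑<-zero n f≈0 = trans (∑<-cong n f≈0) (sum-replicate-zero n)

    ∑<-+ : ∀ n f g → ∑< n (λ i → f i + g i) ≈ ∑< n f + ∑< n g
    ∑<-+ n f g = ∑-distrib-+ {n} (λ i → f (toℕ i)) (λ i → g (toℕ i))

    ∑<-*ˡ : ∀ n x f → x * ∑< n f ≈ ∑< n (λ i → x * f i)
    ∑<-*ˡ n x f = *-distribˡ-sum {n} x (λ i → f (toℕ i))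

    ∑<-comm : ∀ m n (f : ℕ → ℕ → Carrier) →
              ∑< m (λ i → ∑< n (f i)) ≈ ∑< n (λ j → ∑< m (λ i → f i j))
    ∑<-comm m n f = ∑-comm {m} {n} (λ i j → f (toℕ i) (toℕ j))

    ∑<-dropˡ : ∀ m n f → (∀ i → i ℕ.< m → f i ≈ 0#) →
               ∑< (m ℕ.+ n) f ≈ ∑< n (λ i → f (m ℕ.+ i))
    ∑<-dropˡ zero    n f f≈0 = refl
    ∑<-dropˡ (suc m) n f f≈0 = trans
      (+-cong (f≈0 0 (s≤s z≤n)) (∑<-dropˡ m n (λ i → f (suc i)) λ i i<m → f≈0 (suc i) (s≤s i<m)))
      (+-identityˡ _)

    ∑<-dropʳ : ∀ {m n} f → m ℕ.≤ n → (∀ i → m ℕ.≤ i → f i ≈ 0#) → ∑< n f ≈ ∑< m f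
    ∑<-dropʳ {n = n} f z≤n       f≈0 = ∑<-zero n λ i _ → f≈0 i z≤n
    ∑<-dropʳ         f (s≤s m≤n) f≈0 =
      +-congˡ (∑<-dropʳ (λ i → f (suc i)) m≤n λ i m≤i → f≈0 (suc i) (s≤s m≤i))

    -- Both sides are the sum of `g i` over 0 ≤ i ≤ n, with the last or the first term split off.
    ∑<-telescope : ∀ n g → ∑< n g + g n ≈ g 0 + ∑< n (λ i → g (suc i))
    ∑<-telescope zero    g = +-comm _ _
    ∑<-telescope (suc n) g = trans (+-assoc _ _ _) (+-congˡ (∑<-telescope n (λ i → g (suc i))))

  -- The window is -K ≤ k < K; at `K = suc N` it is that of `ℤ-range N`.
  ∑± : ℕ → (ℤ → Carrier) → Carrier
  ∑± K f = ∑< K (λ m → f (+ m)) + ∑< K (λ m → f -[1+ m ])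

  ∑±-cong : ∀ K {f g} → (∀ k → f k ≈ g k) → ∑± K f ≈ ∑± K g
  ∑±-cong K f≈g = +-cong (∑<-cong K λ m _ → f≈g (+ m)) (∑<-cong K λ m _ → f≈g -[1+ m ])

  ∑±-+ : ∀ K f g → ∑± K (λ k → f k + g k) ≈ ∑± K f + ∑± K g
  ∑±-+ K f g = trans
    (+-cong (∑<-+ K (λ m → f (+ m)) (λ m → g (+ m))) (∑<-+ K (λ m → f -[1+ m ]) (λ m → g -[1+ m ])))
    (solve 4 (λ a b c d → (a :+ b) :+ (c :+ d) := (a :+ c) :+ (b :+ d)) refl _ _ _ _)

  ∑±-*ˡ : ∀ K x f → x * ∑± K f ≈ ∑± K (λ k → x * f k)
  ∑±-*ˡ K x f = trans (distribˡ x _ _)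
    (+-cong (∑<-*ˡ K x (λ m → f (+ m))) (∑<-*ˡ K x (λ m → f -[1+ m ])))

  ∑<-∑±-comm : ∀ n K (f : ℕ → ℤ → Carrier) →
               ∑< n (λ i → ∑± K (f i)) ≈ ∑± K (λ k → ∑< n (λ i → f i k))
  ∑<-∑±-comm n K f = trans (∑<-+ n (λ i → ∑< K (λ m → f i (+ m))) (λ i → ∑< K (λ m → f i -[1+ m ])))
    (+-cong (∑<-comm n K (λ i m → f i (+ m))) (∑<-comm n K (λ i m → f i -[1+ m ])))

  -- The shift moves the window from -K,...,K-1 to 1-K,...,K, so only the two end terms differ, and
  -- these vanish by hypothesis.
  ∑±-shift : ∀ K g → g (+ K) ≈ 0# → g (ℤ.- + K) ≈ 0# →
             ∑± K g ≈ ∑± K (λ k → g (1ℤ ℤ.+ k))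
  ∑±-shift K g gK≈0 g-K≈0 = begin
    A + B                 ≈⟨ +-cong (+-identityʳ A) (+-identityʳ B) ⟨
    (A + 0#) + (B + 0#)   ≈⟨ +-congʳ (+-congˡ gK≈0) ⟨
    (A + g (+ K)) + (B + 0#)   ≈⟨ +-congʳ (∑<-telescope K (λ m → g (+ m))) ⟩
    (g 0ℤ + A′) + (B + 0#)     ≈⟨ solve 3 (λ x y z → (x :+ y) :+ z := y :+ (x :+ z)) refl _ _ _ ⟩
    A′ + (g 0ℤ + (B + 0#))     ≈⟨ +-congˡ (+-congˡ (+-identityʳ B)) ⟩
    -- The term at 0 has passed to the negative half, where it heads the sum of `g (ℤ.- + m)`;
    -- `-[1+ m ]` is `ℤ.- + suc m` by computation.
    A′ + (g 0ℤ + B)            ≈⟨ +-congˡ (∑<-telescope K (λ m → g (ℤ.- + m))) ⟨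
    A′ + (∑< K (λ m → g (ℤ.- + m)) + g (ℤ.- + K))
      ≈⟨ +-congˡ (trans (+-congˡ g-K≈0) (+-identityʳ _)) ⟩
    A′ + ∑< K (λ m → g (ℤ.- + m)) ≈⟨ +-congˡ (∑<-cong K λ m _ → reflexive (≡.cong g (1+-[1+ m ]))) ⟨
    A′ + B′ ∎
    where
    A = ∑< K (λ m → g (+ m))
    B = ∑< K (λ m → g -[1+ m ])
    A′ = ∑< K (λ m → g (1ℤ ℤ.+ + m))
    B′ = ∑< K (λ m → g (1ℤ ℤ.+ -[1+ m ]))
    1+-[1+_] : ∀ m → 1ℤ ℤ.+ -[1+ m ] ≡ ℤ.- + m
    1+-[1+ m ] = ≡.trans (ℤ.[1+m]⊖[1+n]≡m⊖n 0 m) (ℤ.⊖-≤ {0} {m} z≤n)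

module Units0 where
open import Algebra.Bundles using (CommutativeRing)
open import Level using (0ℓ)
import Algebra.Solver.Ring.NaturalCoefficients.Default
import Relation.Binary.Reasoning.Setoid

-- Inverses in a commutative ring

module Units {c ℓ} (R : CommutativeRing c ℓ) where
  open CommutativeRing R
  open Algebra.Solver.Ring.NaturalCoefficients.Default commutativeSemiring
    using (solve; _:+_; _:*_; _:=_; con)
  open Relation.Binary.Reasoning.Setoid setoid

  -- With p = 1/q and p′ = 1/q′ the hypotheses give p = (1 - x) p′; moving x p′ across yields the
  -- form of `P-suc`.
  inverse-step : ∀ {q q′ p p′} x → q′ ≈ q * (1# - x) → q * p ≈ 1# → q′ * p′ ≈ 1# → p′ ≈ p + x * p′
  inverse-step {q} {q′} {p} {p′} x q′≈ qp≈1 q′p′≈1 = begin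
    p′                                   ≈⟨ *-identityˡ p′ ⟨
    1# * p′
      ≈⟨ *-congʳ (trans (+-assoc 1# (- x) x) (trans (+-congˡ (-‿inverseˡ x)) (+-identityʳ 1#))) ⟨
    ((1# - x) + x) * p′                  ≈⟨ distribʳ p′ (1# - x) x ⟩
    (1# - x) * p′ + x * p′               ≈⟨ +-congʳ p≈ ⟨
    p + x * p′                           ∎
    where
    p≈ : p ≈ (1# - x) * p′
    p≈ = begin
      p                          ≈⟨ *-identityʳ p ⟨
      p * 1#                     ≈⟨ *-congˡ (trans (*-congʳ (sym q′≈)) q′p′≈1) ⟨
      p * (q * (1# - x) * p′)
        ≈⟨ solve 4 (λ p q d p′ → p :* (q :* d :* p′) := q :* p :* (d :* p′)) refl p q (1# - x) p′ ⟩
      q * p * ((1# - x) * p′)    ≈⟨ *-congʳ qp≈1 ⟩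
      1# * ((1# - x) * p′)       ≈⟨ *-identityˡ _ ⟩
      (1# - x) * p′              ∎

  -- The last step of the theorem: multiplication by `q` = (q;q)∞ removes one factor `p` = 1/(q;q)∞
  -- from both sides of the limit identity.
  cancel-unit : ∀ {q p l r} → q * p ≈ 1# → r * (p * p) ≈ l * p → l ≈ p * r
  cancel-unit {q} {p} {l} {r} qp≈1 eq = begin
    l                  ≈⟨ *-identityˡ l ⟨
    1# * l             ≈⟨ *-congʳ qp≈1 ⟨
    q * p * l          ≈⟨ solve 3 (λ q p l → q :* p :* l := q :* (l :* p)) refl q p l ⟩
    q * (l * p)        ≈⟨ *-congˡ eq ⟨
    q * (r * (p * p))
      ≈⟨ solve 3 (λ q p r → q :* (r :* (p :* p)) := q :* p :* (p :* r)) refl q p r ⟩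
    q * p * (p * r)    ≈⟨ *-congʳ qp≈1 ⟩
    1# * (p * r)       ≈⟨ *-identityˡ _ ⟩
    p * r              ∎

  inverse-swap : ∀ {q q′ p p′} → q * p ≈ 1# → q′ * p′ ≈ 1# → p ≈ p * (q′ * p′)
  inverse-swap {p = p} qp≈1 q′p′≈1 = sym (trans (*-congˡ q′p′≈1) (*-identityʳ p))

-- X n plays the role of qⁿ and P n that of 1/(q;q)ₙ, which is 0 for n < 0.
record QSystem {c ℓ} (R : CommutativeRing c ℓ) : Set (c ⊔ ℓ) where
  open CommutativeRing R
  field
    X        : ℕ → Carrier
    X-zero   : X 0 ≈ 1#
    X-+      : ∀ m n → X (m ℕ.+ n) ≈ X m * X n
    X-cancel : ∀ n y → y ≈ X (suc n) * y → y ≈ 0#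
    P        : ℤ → Carrier
    P-neg    : ∀ n → P -[1+ n ] ≈ 0#
    P-zero   : P 0ℤ ≈ 1#
    P-suc    : ∀ n → P (+ suc n) ≈ P (+ n) + X (suc n) * P (+ suc n)

-- The finite identity

a₁ a₂ : ℤ → ℤ
a₁ k = + 6 ℤ.* (k ℤ.* k) ℤ.- k
a₂ k = + 6 ℤ.* (k ℤ.* k) ℤ.+ + 5 ℤ.* k ℤ.+ 1ℤ

-- The exponents k(6k - 1), (2k + 1)(3k + 1) and r(r + 1) are products of two integers never of
-- strictly opposite sign; the cases below exhibit them as products of naturals.
product-nonneg : ∀ m n {i} → i ≡ + m ℤ.* + n → + ∣ i ∣ ≡ i
product-nonneg m n eq rewrite eq | ≡.sym (ℤ.pos-* m n) = ≡.refl

a₁-nonneg : ∀ k → + ∣ a₁ k ∣ ≡ a₁ k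
a₁-nonneg (+ zero)  = ≡.refl
a₁-nonneg (+ suc m) = product-nonneg (suc m) (5 ℕ.+ (t ℕ.+ t)) (eq (+ m))
  where
  -- Multiples of m are spelled as sums because `+_` commutes with addition by computation, but with
  -- multiplication only through `ℤ.pos-*`.
  t = m ℕ.+ m ℕ.+ m
  eq : ∀ x → let y = x ℤ.+ x ℤ.+ x in
       + 6 ℤ.* ((1ℤ ℤ.+ x) ℤ.* (1ℤ ℤ.+ x)) ℤ.- (1ℤ ℤ.+ x) ≡ (1ℤ ℤ.+ x) ℤ.* (+ 5 ℤ.+ (y ℤ.+ y))
  eq = solve-∀
a₁-nonneg -[1+ m ] = product-nonneg (suc m) (7 ℕ.+ (t ℕ.+ t)) (eq (+ m))
  where
  t = m ℕ.+ m ℕ.+ m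
  eq : ∀ x → let y = x ℤ.+ x ℤ.+ x in let k = ℤ.- (1ℤ ℤ.+ x) in
       + 6 ℤ.* (k ℤ.* k) ℤ.- k ≡ (1ℤ ℤ.+ x) ℤ.* (+ 7 ℤ.+ (y ℤ.+ y))
  eq = solve-∀

a₂-nonneg : ∀ k → + ∣ a₂ k ∣ ≡ a₂ k
a₂-nonneg (+ m) = product-nonneg (1 ℕ.+ (m ℕ.+ m)) (1 ℕ.+ (m ℕ.+ m ℕ.+ m)) (eq (+ m))
  where
  eq : ∀ x →
       + 6 ℤ.* (x ℤ.* x) ℤ.+ + 5 ℤ.* x ℤ.+ 1ℤ ≡ (1ℤ ℤ.+ (x ℤ.+ x)) ℤ.* (1ℤ ℤ.+ (x ℤ.+ x ℤ.+ x))
  eq = solve-∀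
a₂-nonneg -[1+ m ] = product-nonneg (1 ℕ.+ (m ℕ.+ m)) (2 ℕ.+ (m ℕ.+ m ℕ.+ m)) (eq (+ m))
  where
  eq : ∀ x → let k = ℤ.- (1ℤ ℤ.+ x) in
       + 6 ℤ.* (k ℤ.* k) ℤ.+ + 5 ℤ.* k ℤ.+ 1ℤ ≡ (1ℤ ℤ.+ (x ℤ.+ x)) ℤ.* (+ 2 ℤ.+ (x ℤ.+ x ℤ.+ x))
  eq = solve-∀

oblong-nonneg : ∀ r → + ∣ r ℤ.* r ℤ.+ r ∣ ≡ r ℤ.* r ℤ.+ r
oblong-nonneg (+ m) = product-nonneg m (suc m) (eq (+ m))
  where
  eq : ∀ m → m ℤ.* m ℤ.+ m ≡ m ℤ.* (1ℤ ℤ.+ m)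
  eq = solve-∀
oblong-nonneg -[1+ m ] = product-nonneg m (suc m) (eq (+ m))
  where
  eq : ∀ m → (ℤ.- (1ℤ ℤ.+ m)) ℤ.* (ℤ.- (1ℤ ℤ.+ m)) ℤ.+ (ℤ.- (1ℤ ℤ.+ m)) ≡ m ℤ.* (1ℤ ℤ.+ m)
  eq = solve-∀

module FiniteIdentity {c ℓ} {R : CommutativeRing c ℓ} (S : QSystem R) where
  open CommutativeRing R
  open Summation R
  open QSystem S
  open Algebra.Properties.Ring ring
  open Algebra.Solver.Ring.NaturalCoefficients.Default commutativeSemiring
    using (solve; _:+_; _:*_; _:=_; con)
  open Relation.Binary.Reasoning.Setoid setoid

  -- Cancelling 1 - qⁿ⁺¹, and the Pascal rules

  X-cancel-≈ : ∀ n f h → f + X (suc n) * h ≈ h + X (suc n) * f → f ≈ h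
  -- `eq` is (1 - x) f = (1 - x) h with the negative terms moved across; it makes f - h equal to x
  -- (f - h).
  X-cancel-≈ n f h eq = x∙y⁻¹≈ε⇒x≈y f h (X-cancel n (f - h) (begin
    f - h                                   ≈⟨ +-identityʳ _ ⟨
    f - h + 0#                              ≈⟨ +-congˡ (trans (*-congˡ (-‿inverseʳ h)) (zeroʳ x)) ⟨
    f - h + x * (h - h)
      ≈⟨ solve 4 (λ x f h i → (f :+ i) :+ x :* (h :+ i) :=
            (f :+ x :* h) :+ (i :+ x :* i)) refl x f h (- h) ⟩
    (f + x * h) + (- h + x * - h)           ≈⟨ +-congʳ eq ⟩
    (h + x * f) + (- h + x * - h)
      ≈⟨ solve 4 (λ x f h i → (h :+ x :* f) :+ (i :+ x :* i) :=
            x :* (f :+ i) :+ (h :+ i)) refl x f h (- h) ⟩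
    x * (f - h) + (h - h)                   ≈⟨ trans (+-congˡ (-‿inverseʳ h)) (+-identityʳ _) ⟩
    x * (f - h)                             ∎))
    where x = X (suc n)

  -- The induction step shared by `even` and `odd`. Here f, g and p obey (1 - x) f = f′ + r, (1 - x)
  -- g = g′ + r′ and (1 - x) p = p′; once the remainders agree, f = g + p follows from f′ = g′ + p′
  -- by cancelling 1 - x.
  X-cancel-step : ∀ n {f f′ g g′ p p′ r r′} → let x = X (suc n) in
              f ≈ (f′ + r) + x * f → g ≈ (g′ + r′) + x * g → p ≈ p′ + x * p →
              r ≈ r′ → f′ ≈ g′ + p′ → f ≈ g + p
  X-cancel-step n {f} {f′} {g} {g′} {p} {p′} {r} {r′} f≈ g≈ p≈ r≈ f′≈ =
    X-cancel-≈ n f (g + p) (begin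
      f + x * (g + p)                          ≈⟨ +-congʳ f≈ ⟩
      ((f′ + r) + x * f) + x * (g + p)         ≈⟨ +-congʳ (+-congʳ (+-cong f′≈ r≈)) ⟩
      (((g′ + p′) + r′) + x * f) + x * (g + p) ≈⟨ solve 7 (λ g′ p′ r′ x f g p →
         (((g′ :+ p′) :+ r′) :+ x :* f) :+ x :* (g :+ p) :=
         (((g′ :+ r′) :+ x :* g) :+ (p′ :+ x :* p)) :+ x :* f) refl g′ p′ r′ x f g p ⟩
      (((g′ + r′) + x * g) + (p′ + x * p)) + x * f  ≈⟨ +-congʳ (+-cong g≈ p≈) ⟨
      (g + p) + x * f ∎)
    where x = X (suc n)

  -- At u = 0 the vanishing of 1 - q⁰ meets 1/(q;q)₋₁ = 0; below 0 every term vanishes.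
  P-pred : ∀ u → P u ≈ P (u ℤ.- 1ℤ) + X ∣ u ∣ * P u
  P-pred (+ zero)  = sym (trans (+-cong (P-neg 0) (trans (*-congʳ X-zero) (*-identityˡ _)))
      (+-identityˡ _))
  P-pred (+ suc n) = P-suc n
  P-pred -[1+ n ]  = trans (P-neg n) (sym (trans
    (+-cong (P-neg _) (trans (*-congˡ (P-neg n)) (zeroʳ _))) (+-identityˡ _)))

  -- When y < 0 the junk powers X ∣ y ∣ and X ∣ z ∣ are harmless, as P y ≈ 0#.
  X-merge : ∀ {x z} m y → + m ≡ x → x ℤ.+ y ≡ z → X m * (X ∣ y ∣ * P y) ≈ X ∣ z ∣ * P y
  X-merge m (+ n)    ≡.refl ≡.refl = trans (sym (*-assoc _ _ _)) (*-congʳ (sym (X-+ m n)))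
  X-merge m -[1+ n ] ≡.refl ≡.refl = trans
    (trans (*-congˡ (trans (*-congˡ (P-neg n)) (zeroʳ _))) (zeroʳ _))
    (sym (trans (*-congˡ (P-neg n)) (zeroʳ _)))

  -- Multiply 1 - qᵘ⁺ᵛ = (1 - qᵛ) + qᵛ (1 - qᵘ) by `P u * P v`. For u, v ≥ 0 that product is
  -- [u+v; u] / (q;q)ᵤ₊ᵥ, and this is a q-Pascal rule.
  pascal : ∀ u v → P u * P v ≈
           (P u * P (v ℤ.- 1ℤ) + P (u ℤ.- 1ℤ) * (X ∣ v ∣ * P v)) + X ∣ u ℤ.+ v ∣ * (P u * P v)
  pascal (+ m) v = begin
    Pu * P v
      ≈⟨ *-congˡ (P-pred v) ⟩
    Pu * (P (v ℤ.- 1ℤ) + X ∣ v ∣ * P v)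
      ≈⟨ distribˡ _ _ _ ⟩
    Pu * P (v ℤ.- 1ℤ) + Pu * (X ∣ v ∣ * P v)
      ≈⟨ +-congˡ (*-congʳ (P-pred (+ m))) ⟩
    Pu * P (v ℤ.- 1ℤ) + (P (+ m ℤ.- 1ℤ) + X m * Pu) * (X ∣ v ∣ * P v)
      ≈⟨ solve 5 (λ a b c d e → a :+ (b :+ c :* d) :* e :=
            (a :+ b :* e) :+ d :* (c :* e)) refl _ _ _ _ _ ⟩
    (Pu * P (v ℤ.- 1ℤ) + P (+ m ℤ.- 1ℤ) * (X ∣ v ∣ * P v)) + Pu * (X m * (X ∣ v ∣ * P v))
      ≈⟨ +-congˡ (*-congˡ (X-merge m v ≡.refl ≡.refl)) ⟩
    (Pu * P (v ℤ.- 1ℤ) + P (+ m ℤ.- 1ℤ) * (X ∣ v ∣ * P v)) + Pu * (X ∣ + m ℤ.+ v ∣ * P v)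
      ≈⟨ +-congˡ (solve 3 (λ a b c → a :* (b :* c) := b :* (a :* c)) refl _ _ _) ⟩
    (Pu * P (v ℤ.- 1ℤ) + P (+ m ℤ.- 1ℤ) * (X ∣ v ∣ * P v)) + X ∣ + m ℤ.+ v ∣ * (Pu * P v)
      ∎
    where Pu = P (+ m)
  pascal -[1+ m ] v = trans (trans (*-congʳ (P-neg m)) (zeroˡ _)) (sym (begin
    (P -[1+ m ] * P (v ℤ.- 1ℤ) + P (-[1+ m ] ℤ.- 1ℤ) * e) + d * (P -[1+ m ] * P v)
      ≈⟨ +-cong (+-cong (*-congʳ (P-neg m)) (*-congʳ (P-neg _))) (*-congˡ (*-congʳ (P-neg m))) ⟩
    (0# * P (v ℤ.- 1ℤ) + 0# * e) + d * (0# * P v)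
      ≈⟨ solve 4 (λ a e d c → (con 0 :* a :+ con 0 :* e) :+ d :* (con 0 :* c) :=
            con 0) refl _ _ _ _ ⟩
    0# ∎))
    where
    e = X ∣ v ∣ * P v
    d = X ∣ -[1+ m ] ℤ.+ v ∣

  opaque
    -- For natural arguments, qᵉ [u+v; u] / (q;q)ᵤ₊ᵥ. All arguments are integers so that exponents
    -- and indices can be matched by ring identities; a negative e arises only beside a vanishing
    -- `P`.
    W : ℤ → ℤ → ℤ → Carrier
    W e u v = X ∣ e ∣ * (P u * P v)

    W-def : ∀ e u v → W e u v ≈ X ∣ e ∣ * (P u * P v)
    W-def e u v = refl

    W-comm : ∀ e u v → W e u v ≈ W e v u
    W-comm e u v = *-congˡ (*-comm _ _)

    W-pascal : ∀ {e u v u′ v′ e′ L} →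
               + ∣ e ∣ ≡ e → u ℤ.- 1ℤ ≡ u′ → v ℤ.- 1ℤ ≡ v′ → e ℤ.+ v ≡ e′ → u ℤ.+ v ≡ + L →
               W e u v ≈ (W e u v′ + W e′ u′ v) + X L * W e u v
    W-pascal {e} {u} {v} {L = L} e≥0 ≡.refl ≡.refl ≡.refl u+v≡L = begin
      x * (P u * P v)
        ≈⟨ *-congˡ (pascal u v) ⟩
      x * ((P u * P v′ + P u′ * (X ∣ v ∣ * P v)) + X ∣ u ℤ.+ v ∣ * (P u * P v))
        ≈⟨ solve 6 (λ x a b c d e → x :* ((a :+ b :* c) :+ d :* e) :=
              (x :* a :+ b :* (x :* c)) :+ d :* (x :* e)) refl x _ _ _ _ _ ⟩
      (x * (P u * P v′) + P u′ * (x * (X ∣ v ∣ * P v))) + X ∣ u ℤ.+ v ∣ * (x * (P u * P v))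
        ≈⟨ +-cong (+-congˡ (*-congˡ (X-merge ∣ e ∣ v e≥0 ≡.refl)))
            (*-congʳ (reflexive (≡.cong (λ z → X ∣ z ∣) u+v≡L))) ⟩
      (x * (P u * P v′) + P u′ * (X ∣ e ℤ.+ v ∣ * P v)) + X L * (x * (P u * P v))
        ≈⟨ +-congʳ (+-congˡ (solve 3 (λ a b c → a :* (b :* c) := b :* (a :* c)) refl _ _ _)) ⟩
      (x * (P u * P v′) + X ∣ e ℤ.+ v ∣ * (P u′ * P v)) + X L * (x * (P u * P v))
        ∎
      where
      x : Carrier
      x = X ∣ e ∣
      u′ v′ : ℤ
      u′ = u ℤ.- 1ℤ
      v′ = v ℤ.- 1ℤ

  -- The other q-Pascal rule, by the symmetry of u and v. The steps from 2n to 2n+1 use `W-pascal`,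
  -- those from 2n+1 to 2n+2 use this one.
  W-pascalʳ : ∀ {e u v u′ v′ e′ L} →
             + ∣ e ∣ ≡ e → u ℤ.- 1ℤ ≡ u′ → v ℤ.- 1ℤ ≡ v′ → e ℤ.+ u ≡ e′ → v ℤ.+ u ≡ + L →
             W e u v ≈ (W e u′ v + W e′ u v′) + X L * W e u v
  W-pascalʳ {e} {u} {v} {u′} {v′} {e′} {L} e≥0 u≡ v≡ e≡ L≡ = begin
    W e u v ≈⟨ W-comm e u v ⟩
    W e v u ≈⟨ W-pascal e≥0 v≡ u≡ e≡ L≡ ⟩
    (W e v u′ + W e′ v′ u) + X L * W e v u
      ≈⟨ +-cong (+-cong (W-comm e v u′) (W-comm e′ v′ u)) (*-congˡ (W-comm e v u)) ⟩
    (W e u′ v + W e′ u v′) + X L * W e u v ∎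

  -- Spelling `-[1+ n ]` as -(1 + n) turns negativity of an index into a ring identity with an
  -- explicit witness n.
  P-neg-at : ∀ n {u} → u ≡ ℤ.- (1ℤ ℤ.+ + n) → P u ≈ 0#
  P-neg-at n ≡.refl = P-neg n

  W-negˡ : ∀ e {u} v n → u ≡ ℤ.- (1ℤ ℤ.+ + n) → W e u v ≈ 0#
  W-negˡ e v n u≡ = trans (W-def _ _ _)
    (trans (*-congˡ (trans (*-congʳ (P-neg-at n u≡)) (zeroˡ _))) (zeroʳ _))

  W-negʳ : ∀ e u {v} n → v ≡ ℤ.- (1ℤ ℤ.+ + n) → W e u v ≈ 0#
  W-negʳ e u {v} n v≡ = trans (W-comm e u v) (W-negˡ e u n v≡)

  W-cong : ∀ {e u v e′ u′ v′} → e ≡ e′ → u ≡ u′ → v ≡ v′ → W e u v ≈ W e′ u′ v′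
  W-cong ≡.refl ≡.refl ≡.refl = refl

  -- The polynomial identity for 2n and 2n+1, divided by (q;q)₂ₙ and (q;q)₂ₙ₊₁

  even₁ even₂ odd₁ odd₂ : ℤ → ℤ → Carrier
  even₁ n k = W (a₁ k) (n ℤ.+ + 3 ℤ.* k) (n ℤ.- + 3 ℤ.* k)
  even₂ n k = W (a₂ k) (n ℤ.- + 3 ℤ.* k ℤ.- 1ℤ) (n ℤ.+ + 3 ℤ.* k ℤ.+ 1ℤ)
  odd₁ n k = W (a₁ k) (n ℤ.+ + 3 ℤ.* k) (n ℤ.- + 3 ℤ.* k ℤ.+ 1ℤ)
  odd₂ n k = W (a₂ k) (n ℤ.- + 3 ℤ.* k ℤ.- 1ℤ) (n ℤ.+ + 3 ℤ.* k ℤ.+ + 2)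

  -- The remainder of odd₁-step; that of odd₂-step is the same at 1 + k, so the
  -- two bilateral sums of remainders agree by a shift of k.
  oddRest : ℤ → ℤ → Carrier
  oddRest n k = W (a₁ k ℤ.+ (n ℤ.- + 3 ℤ.* k ℤ.+ 1ℤ))
                  (n ℤ.+ + 3 ℤ.* k ℤ.- 1ℤ) (n ℤ.- + 3 ℤ.* k ℤ.+ 1ℤ)

  odd₁-step : ∀ n k →
              odd₁ (+ n) k ≈
              (even₁ (+ n) k + oddRest (+ n) k) + X (suc (n ℕ.+ n)) * odd₁ (+ n) k
  odd₁-step n k = W-pascal (a₁-nonneg k) ≡.refl (v≡ (+ n) k) ≡.refl (L≡ (+ n) k)
    where
    v≡ : ∀ n k → n ℤ.- + 3 ℤ.* k ℤ.+ 1ℤ ℤ.- 1ℤ ≡ n ℤ.- + 3 ℤ.* k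
    v≡ = solve-∀
    L≡ : ∀ n k → n ℤ.+ + 3 ℤ.* k ℤ.+ (n ℤ.- + 3 ℤ.* k ℤ.+ 1ℤ) ≡ 1ℤ ℤ.+ (n ℤ.+ n)
    L≡ = solve-∀

  odd₂-step : ∀ n k →
              odd₂ (+ n) k ≈
              (even₂ (+ n) k + oddRest (+ n) (1ℤ ℤ.+ k)) + X (suc (n ℕ.+ n)) * odd₂ (+ n) k
  odd₂-step n k = trans
    (W-pascal (a₂-nonneg k) (u≡ (+ n) k) (v≡ (+ n) k) (e≡ (+ n) k) (L≡ (+ n) k))
    (+-congʳ (+-congˡ (trans (W-comm _ _ _) (W-cong ≡.refl (u′≡ (+ n) k) ≡.refl))))
    where
    u≡ : ∀ n k → n ℤ.- + 3 ℤ.* k ℤ.- 1ℤ ℤ.- 1ℤ ≡ n ℤ.- + 3 ℤ.* (1ℤ ℤ.+ k) ℤ.+ 1ℤ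
    u≡ = solve-∀
    v≡ : ∀ n k → n ℤ.+ + 3 ℤ.* k ℤ.+ + 2 ℤ.- 1ℤ ≡ n ℤ.+ + 3 ℤ.* k ℤ.+ 1ℤ
    v≡ = solve-∀
    e≡ : ∀ n k → + 6 ℤ.* (k ℤ.* k) ℤ.+ + 5 ℤ.* k ℤ.+ 1ℤ ℤ.+ (n ℤ.+ + 3 ℤ.* k ℤ.+ + 2)
               ≡ + 6 ℤ.* ((1ℤ ℤ.+ k) ℤ.* (1ℤ ℤ.+ k)) ℤ.- (1ℤ ℤ.+ k) ℤ.+
                   (n ℤ.- + 3 ℤ.* (1ℤ ℤ.+ k) ℤ.+ 1ℤ)
    e≡ = solve-∀
    L≡ : ∀ n k → n ℤ.- + 3 ℤ.* k ℤ.- 1ℤ ℤ.+ (n ℤ.+ + 3 ℤ.* k ℤ.+ + 2) ≡ 1ℤ ℤ.+ (n ℤ.+ n)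
    L≡ = solve-∀
    u′≡ : ∀ n k → n ℤ.+ + 3 ℤ.* k ℤ.+ + 2 ≡ n ℤ.+ + 3 ℤ.* (1ℤ ℤ.+ k) ℤ.- 1ℤ
    u′≡ = solve-∀

  -- Here `even₁-step` and `even₂-step` leave the same remainder at the same k, because a₁(k) + (n +
  -- 1 + 3k) = a₂(k) + (n - 3k).
  evenRest : ℤ → ℤ → Carrier
  evenRest n k = W (a₂ k ℤ.+ (n ℤ.- + 3 ℤ.* k)) (n ℤ.- + 3 ℤ.* k) (n ℤ.+ + 3 ℤ.* k ℤ.+ 1ℤ)

  even₁-step : ∀ n k →
               even₁ (+ suc n) k ≈
               (odd₁ (+ n) k + evenRest (+ n) k) + X (suc (suc (n ℕ.+ n))) * even₁ (+ suc n) k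
  even₁-step n k = trans
    (W-pascalʳ (a₁-nonneg k) (u≡ (+ n) k) (v≡ (+ n) k) (e≡ (+ n) k) (L≡ (+ n) k))
    (+-congʳ (+-cong (W-cong ≡.refl ≡.refl (v′≡ (+ n) k))
        (trans (W-comm _ _ _) (W-cong ≡.refl ≡.refl (u′≡ (+ n) k)))))
    where
    u≡ : ∀ n k → 1ℤ ℤ.+ n ℤ.+ + 3 ℤ.* k ℤ.- 1ℤ ≡ n ℤ.+ + 3 ℤ.* k
    u≡ = solve-∀
    v≡ : ∀ n k → 1ℤ ℤ.+ n ℤ.- + 3 ℤ.* k ℤ.- 1ℤ ≡ n ℤ.- + 3 ℤ.* k
    v≡ = solve-∀
    e≡ : ∀ n k → + 6 ℤ.* (k ℤ.* k) ℤ.- k ℤ.+ (1ℤ ℤ.+ n ℤ.+ + 3 ℤ.* k)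
               ≡ + 6 ℤ.* (k ℤ.* k) ℤ.+ + 5 ℤ.* k ℤ.+ 1ℤ ℤ.+ (n ℤ.- + 3 ℤ.* k)
    e≡ = solve-∀
    L≡ : ∀ n k → 1ℤ ℤ.+ n ℤ.- + 3 ℤ.* k ℤ.+ (1ℤ ℤ.+ n ℤ.+ + 3 ℤ.* k) ≡ + 2 ℤ.+ (n ℤ.+ n)
    L≡ = solve-∀
    v′≡ : ∀ n k → 1ℤ ℤ.+ n ℤ.- + 3 ℤ.* k ≡ n ℤ.- + 3 ℤ.* k ℤ.+ 1ℤ
    v′≡ = solve-∀
    u′≡ : ∀ n k → 1ℤ ℤ.+ n ℤ.+ + 3 ℤ.* k ≡ n ℤ.+ + 3 ℤ.* k ℤ.+ 1ℤ
    u′≡ = solve-∀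

  even₂-step : ∀ n k →
               even₂ (+ suc n) k ≈
               (odd₂ (+ n) k + evenRest (+ n) k) + X (suc (suc (n ℕ.+ n))) * even₂ (+ suc n) k
  even₂-step n k = trans
    (W-pascalʳ (a₂-nonneg k) (u≡ (+ n) k) (v≡ (+ n) k) (e≡ (+ n) k) (L≡ (+ n) k))
    (+-congʳ (+-cong (W-cong ≡.refl ≡.refl (v′≡ (+ n) k)) (W-cong ≡.refl (u′≡ (+ n) k) ≡.refl)))
    where
    u≡ : ∀ n k → 1ℤ ℤ.+ n ℤ.- + 3 ℤ.* k ℤ.- 1ℤ ℤ.- 1ℤ ≡ n ℤ.- + 3 ℤ.* k ℤ.- 1ℤ
    u≡ = solve-∀
    v≡ : ∀ n k → 1ℤ ℤ.+ n ℤ.+ + 3 ℤ.* k ℤ.+ 1ℤ ℤ.- 1ℤ ≡ n ℤ.+ + 3 ℤ.* k ℤ.+ 1ℤ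
    v≡ = solve-∀
    e≡ : ∀ n k → + 6 ℤ.* (k ℤ.* k) ℤ.+ + 5 ℤ.* k ℤ.+ 1ℤ ℤ.+ (1ℤ ℤ.+ n ℤ.- + 3 ℤ.* k ℤ.- 1ℤ)
               ≡ + 6 ℤ.* (k ℤ.* k) ℤ.+ + 5 ℤ.* k ℤ.+ 1ℤ ℤ.+ (n ℤ.- + 3 ℤ.* k)
    e≡ = solve-∀
    L≡ : ∀ n k →
         1ℤ ℤ.+ n ℤ.+ + 3 ℤ.* k ℤ.+ 1ℤ ℤ.+ (1ℤ ℤ.+ n ℤ.- + 3 ℤ.* k ℤ.- 1ℤ) ≡ + 2 ℤ.+ (n ℤ.+ n)
    L≡ = solve-∀
    v′≡ : ∀ n k → 1ℤ ℤ.+ n ℤ.+ + 3 ℤ.* k ℤ.+ 1ℤ ≡ n ℤ.+ + 3 ℤ.* k ℤ.+ + 2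
    v′≡ = solve-∀
    u′≡ : ∀ n k → 1ℤ ℤ.+ n ℤ.- + 3 ℤ.* k ℤ.- 1ℤ ≡ n ℤ.- + 3 ℤ.* k
    u′≡ = solve-∀

  -- At the ends ±K that `∑±-shift` inspects, one index is negative: with K = 1 + n + t it is -(2 +
  -- 2n + 3t) here and -(4 + 2n + 3t) at -K.
  oddRest-vanishes⁺ : ∀ n K → n ℕ.< K → oddRest (+ n) (+ K) ≈ 0#
  oddRest-vanishes⁺ n K n<K with ℕ.m≤n⇒∃[o]m+o≡n n<K
  ... | t , ≡.refl = W-negʳ _ _ (1 ℕ.+ (n ℕ.+ n ℕ.+ (t ℕ.+ t ℕ.+ t))) (eq (+ n) (+ t))
    where
    eq : ∀ n t →
         n ℤ.- + 3 ℤ.* (1ℤ ℤ.+ (n ℤ.+ t)) ℤ.+ 1ℤ ≡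
         ℤ.- (1ℤ ℤ.+ (1ℤ ℤ.+ (n ℤ.+ n ℤ.+ (t ℤ.+ t ℤ.+ t))))
    eq = solve-∀

  oddRest-vanishes⁻ : ∀ n K → n ℕ.< K → oddRest (+ n) (ℤ.- + K) ≈ 0#
  oddRest-vanishes⁻ n K n<K with ℕ.m≤n⇒∃[o]m+o≡n n<K
  ... | t , ≡.refl = W-negˡ _ _ (3 ℕ.+ (n ℕ.+ n ℕ.+ (t ℕ.+ t ℕ.+ t))) (eq (+ n) (+ t))
    where
    eq : ∀ n t →
         n ℤ.+ + 3 ℤ.* (ℤ.- (1ℤ ℤ.+ (n ℤ.+ t))) ℤ.- 1ℤ ≡
         ℤ.- (1ℤ ℤ.+ (+ 3 ℤ.+ (n ℤ.+ n ℤ.+ (t ℤ.+ t ℤ.+ t))))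
    eq = solve-∀

  ∑±-step : ∀ K L {f f′ r} → (∀ k → f k ≈ (f′ k + r k) + X L * f k) →
            ∑± K f ≈ (∑± K f′ + ∑± K r) + X L * ∑± K f
  ∑±-step K L {f} {f′} {r} step = begin
    ∑± K f                                          ≈⟨ ∑±-cong K step ⟩
    ∑± K (λ k → (f′ k + r k) + X L * f k)           ≈⟨ ∑±-+ K (λ k → f′ k + r k) (λ k → X L * f k) ⟩
    ∑± K (λ k → f′ k + r k) + ∑± K (λ k → X L * f k)
      ≈⟨ +-cong (∑±-+ K f′ r) (sym (∑±-*ˡ K (X L) f)) ⟩
    (∑± K f′ + ∑± K r) + X L * ∑± K f               ∎

  -- At n = 0 the indices 3k and -3k are both non-negative only for k = 0, where the term is 1; the
  -- indices of `even₂` are opposite and nonzero, so one is always negative.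
  even-zero : ∀ K → ∑± (suc K) (even₁ 0ℤ) ≈ ∑± (suc K) (even₂ 0ℤ) + P 0ℤ
  even-zero K = begin
    ∑< (suc K) (λ m → even₁ 0ℤ (+ m)) + ∑< (suc K) (λ m → even₁ 0ℤ -[1+ m ])
      ≈⟨ +-congʳ (∑<-suc K (λ m → even₁ 0ℤ (+ m))) ⟩
    (even₁ 0ℤ 0ℤ + ∑< K (λ m → even₁ 0ℤ (+ suc m))) + ∑< (suc K) (λ m → even₁ 0ℤ -[1+ m ])
      ≈⟨ +-cong (+-cong even₁00 (∑<-zero K λ m _ → W-negʳ _ _ (2 ℕ.+ (m ℕ.+ m ℕ.+ m)) (neg₁ (+ m))))
                (∑<-zero (suc K) λ m _ → W-negˡ _ _ (2 ℕ.+ (m ℕ.+ m ℕ.+ m)) (neg₂ (+ m))) ⟩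
    (1# + 0#) + 0#
      ≈⟨ solve 0 ((con 1 :+ con 0) :+ con 0 := (con 0 :+ con 0) :+ con 1) refl ⟩
    (0# + 0#) + 1#
      ≈⟨ +-cong (+-cong (∑<-zero (suc K) λ m _ → W-negˡ _ _ (m ℕ.+ m ℕ.+ m) (neg₃ (+ m)))
                        (∑<-zero (suc K) λ m _ → W-negʳ _ _ (1 ℕ.+ (m ℕ.+ m ℕ.+ m))
                            (neg₄ (+ m)))) P-zero ⟨
    (∑< (suc K) (λ m → even₂ 0ℤ (+ m)) + ∑< (suc K) (λ m → even₂ 0ℤ -[1+ m ])) + P 0ℤ ∎
    where
    even₁00 : even₁ 0ℤ 0ℤ ≈ 1#
    even₁00 = trans (W-def _ _ _) (trans (*-cong X-zero (*-cong P-zero P-zero))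
        (trans (*-identityˡ _) (*-identityˡ _)))
    neg₁ : ∀ m → 0ℤ ℤ.- + 3 ℤ.* (1ℤ ℤ.+ m) ≡ ℤ.- (1ℤ ℤ.+ (+ 2 ℤ.+ (m ℤ.+ m ℤ.+ m)))
    neg₁ = solve-∀
    neg₂ : ∀ m → 0ℤ ℤ.+ + 3 ℤ.* (ℤ.- (1ℤ ℤ.+ m)) ≡ ℤ.- (1ℤ ℤ.+ (+ 2 ℤ.+ (m ℤ.+ m ℤ.+ m)))
    neg₂ = solve-∀
    neg₃ : ∀ m → 0ℤ ℤ.- + 3 ℤ.* m ℤ.- 1ℤ ≡ ℤ.- (1ℤ ℤ.+ (m ℤ.+ m ℤ.+ m))
    neg₃ = solve-∀
    neg₄ : ∀ m → 0ℤ ℤ.+ + 3 ℤ.* (ℤ.- (1ℤ ℤ.+ m)) ℤ.+ 1ℤ ≡ ℤ.- (1ℤ ℤ.+ (1ℤ ℤ.+ (m ℤ.+ m ℤ.+ m)))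
    neg₄ = solve-∀

  -- K stays fixed through the induction, so one window serves every n < K at once, as the summation
  -- over n in `finite-identity` requires.
  even : ∀ K n → n ℕ.< K → ∑± K (even₁ (+ n)) ≈ ∑± K (even₂ (+ n)) + P (+ (n ℕ.+ n))
  odd  : ∀ K n → n ℕ.< K → ∑± K (odd₁ (+ n)) ≈ ∑± K (odd₂ (+ n)) + P (+ suc (n ℕ.+ n))
  even (suc K) zero    0<K   = even-zero K
  even K       (suc n) 1+n<K = begin
    ∑± K (even₁ (+ suc n))
      ≈⟨ X-cancel-step _ (∑±-step K L (even₁-step n)) (∑±-step K L (even₂-step n)) (P-suc _) refl
           (odd K n (ℕ.<-trans (ℕ.n<1+n n) 1+n<K)) ⟩
    ∑± K (even₂ (+ suc n)) + P (+ L)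
      ≡⟨ ≡.cong (λ l → ∑± K (even₂ (+ suc n)) + P (+ suc l)) (≡.sym (ℕ.+-suc n n)) ⟩
    ∑± K (even₂ (+ suc n)) + P (+ (suc n ℕ.+ suc n)) ∎
    where L = suc (suc (n ℕ.+ n))
  odd K n n<K = X-cancel-step _ (∑±-step K L (odd₁-step n)) (∑±-step K L (odd₂-step n)) (P-suc _)
    (∑±-shift K (oddRest (+ n)) (oddRest-vanishes⁺ n K n<K) (oddRest-vanishes⁻ n K n<K))
        (even K n n<K)
    where L = suc (n ℕ.+ n)

  -- The finite Durfee rectangle identity

  W-scale : ∀ c d {e} u v → e ≡ + (c ℕ.+ d) → W e u v ≈ X c * W (+ d) u v
  W-scale c d u v ≡.refl = begin
    W (+ (c ℕ.+ d)) u v          ≈⟨ W-def _ u v ⟩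
    X (c ℕ.+ d) * (P u * P v)    ≈⟨ *-congʳ (X-+ c d) ⟩
    X c * X d * (P u * P v)      ≈⟨ *-assoc _ _ _ ⟩
    X c * (X d * (P u * P v))    ≈⟨ *-congˡ (W-def _ u v) ⟨
    X c * W (+ d) u v            ∎

  -- Multiplied by (q;q)ₐ this is q^(m(m+s)) [a; m] / (q;q)ₘ₊ₛ for m ≤ a, the generating function of
  -- partitions with parts at most a + s and Durfee rectangle m by m + s: [a; m] counts what lies
  -- beside the rectangle, 1/(q;q)ₘ₊ₛ what lies below.
  durfee : ℕ → ℕ → ℕ → Carrier
  durfee a s m = W (+ (m ℕ.* (m ℕ.+ s))) (+ m) (+ a ℤ.- + m) * P (+ (m ℕ.+ s))

  durfee-rest : ℕ → ℕ → ℕ → Carrier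
  durfee-rest a s m =
    W (+ (m ℕ.* (m ℕ.+ s)) ℤ.+ (+ suc a ℤ.- + m)) (+ m ℤ.- 1ℤ) (+ suc a ℤ.- + m) * P (+ (m ℕ.+ s))

  durfee-step : ∀ a s m → durfee (suc a) s m ≈
                (durfee a s m + durfee-rest a s m) + X (suc a) * durfee (suc a) s m
  durfee-step a s m = trans
    (*-congʳ (W-pascal ≡.refl ≡.refl (v≡ (+ a) (+ m)) ≡.refl (L≡ (+ a) (+ m))))
    (solve 5 (λ x y z w p → ((x :+ y) :+ z :* w) :* p :=
          (x :* p :+ y :* p) :+ z :* (w :* p)) refl _ _ _ _ _)
    where
    v≡ : ∀ a m → 1ℤ ℤ.+ a ℤ.- m ℤ.- 1ℤ ≡ a ℤ.- m
    v≡ = solve-∀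
    L≡ : ∀ a m → m ℤ.+ (1ℤ ℤ.+ a ℤ.- m) ≡ 1ℤ ℤ.+ a
    L≡ = solve-∀

  durfee-rest-zero : ∀ a s → durfee-rest a s 0 ≈ 0#
  durfee-rest-zero a s = trans (*-congʳ (W-negˡ _ _ 0 ≡.refl)) (zeroˡ _)

  -- Since (m+1)(m+1+s) + (a-m) = (a+s+1) + m(m+s+1), the remainder is again a Durfee term, for a
  -- rectangle with s raised by one.
  durfee-rest-suc : ∀ a s m → durfee-rest a s (suc m) ≈ X (suc (a ℕ.+ s)) * durfee a (suc s) m
  durfee-rest-suc a s m = begin
    durfee-rest a s (suc m)
      ≈⟨ *-congʳ (trans (W-cong ≡.refl (u≡ (+ m)) (v≡ (+ a) (+ m)))
           (W-scale (suc (a ℕ.+ s)) (m ℕ.* (m ℕ.+ suc s)) (+ m) (+ a ℤ.- + m) e≡)) ⟩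
    X (suc (a ℕ.+ s)) * W (+ (m ℕ.* (m ℕ.+ suc s))) (+ m) (+ a ℤ.- + m) * P (+ (suc m ℕ.+ s))
      ≈⟨ *-assoc _ _ _ ⟩
    X (suc (a ℕ.+ s)) * (W (+ (m ℕ.* (m ℕ.+ suc s))) (+ m) (+ a ℤ.- + m) * P (+ (suc m ℕ.+ s)))
      ≡⟨ ≡.cong (λ l → X (suc (a ℕ.+ s)) *
          (W (+ (m ℕ.* (m ℕ.+ suc s))) (+ m) (+ a ℤ.- + m) * P (+ l)))
           (≡.sym (ℕ.+-suc m s)) ⟩
    X (suc (a ℕ.+ s)) * durfee a (suc s) m ∎
    where
    u≡ : ∀ m → 1ℤ ℤ.+ m ℤ.- 1ℤ ≡ m
    u≡ = solve-∀
    v≡ : ∀ a m → 1ℤ ℤ.+ a ℤ.- (1ℤ ℤ.+ m) ≡ a ℤ.- m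
    v≡ = solve-∀
    eq : ∀ a s m → (1ℤ ℤ.+ m) ℤ.* (1ℤ ℤ.+ m ℤ.+ s) ℤ.+ (1ℤ ℤ.+ a ℤ.- (1ℤ ℤ.+ m))
                   ≡ (1ℤ ℤ.+ (a ℤ.+ s)) ℤ.+ m ℤ.* (m ℤ.+ (1ℤ ℤ.+ s))
    eq = solve-∀
    e≡ : + (suc m ℕ.* (suc m ℕ.+ s)) ℤ.+ (+ suc a ℤ.- + suc m) ≡
         + (suc (a ℕ.+ s) ℕ.+ m ℕ.* (m ℕ.+ suc s))
    e≡ = ≡.trans (≡.cong (ℤ._+ (+ suc a ℤ.- + suc m)) (ℤ.pos-* (suc m) (suc m ℕ.+ s)))
      (≡.trans (eq (+ a) (+ s) (+ m))
        (≡.cong (λ z → + suc (a ℕ.+ s) ℤ.+ z) (≡.sym (ℤ.pos-* m (m ℕ.+ suc s)))))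

  -- Induction on a for all s together. Writing D(a,s) for the sum, the steps give (1 - qᵃ⁺¹)
  -- D(a+1,s) = D(a,s) + q^(a+s+1) D(a,s+1), and the product on the right obeys the same recursion.
  -- The bound M is free because one recursive call keeps `suc M` and the other drops to `M`.
  ∑-durfee : ∀ a M s → a ℕ.< M → ∑< M (durfee a s) ≈ P (+ a) * P (+ (a ℕ.+ s))
  ∑-durfee zero (suc M) s _ = begin
    ∑< (suc M) (durfee 0 s)                       ≈⟨ ∑<-suc M (durfee 0 s) ⟩
    durfee 0 s 0 + ∑< M (λ m → durfee 0 s (suc m))
      ≈⟨ +-cong (*-congʳ (trans (W-def _ _ _) (*-cong X-zero (*-congˡ P-zero))))
           (∑<-zero M λ m _ → trans (*-congʳ (W-negʳ _ _ m ≡.refl)) (zeroˡ _)) ⟩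
    1# * (P 0ℤ * 1#) * P (+ s) + 0#
      ≈⟨ solve 2 (λ x y → con 1 :* (x :* con 1) :* y :+ con 0 := x :* y) refl _ _ ⟩
    P 0ℤ * P (+ s) ∎
  ∑-durfee (suc a) (suc M) s (s≤s a<M) = X-cancel-≈ a f h (begin
    f + x * h                                        ≈⟨ +-congʳ f≈ ⟩
    ((f₁ + f₂) + x * f) + x * h                      ≈⟨ +-congʳ (+-congʳ (+-cong f₁≈ f₂≈)) ⟩
    ((p * q + y * (p * q′)) + x * f) + x * h         ≈⟨ solve 7 (λ p q y q′ x f h →
        ((p :* q :+ y :* (p :* q′)) :+ x :* f) :+ x :* h :=
              (p :* (q :+ y :* q′) :+ x :* h) :+ x :* f) refl p q y q′ x f h ⟩
    (p * (q + y * q′) + x * h) + x * f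
      ≈⟨ +-congʳ (+-congʳ (*-congˡ (P-suc (a ℕ.+ s)))) ⟨
    (p * q′ + x * (P (+ suc a) * q′)) + x * f
      ≈⟨ +-congʳ (solve 4 (λ p q′ x r → p :* q′ :+ x :* (r :* q′) :=
            (p :+ x :* r) :* q′) refl p q′ x _) ⟩
    (p + x * P (+ suc a)) * q′ + x * f               ≈⟨ +-congʳ (*-congʳ (P-suc a)) ⟨
    h + x * f                                        ∎)
    where
    x y p q q′ f h f₁ f₂ : Carrier
    x = X (suc a)
    y = X (suc (a ℕ.+ s))
    p = P (+ a)
    q = P (+ (a ℕ.+ s))
    q′ = P (+ suc (a ℕ.+ s))
    f = ∑< (suc M) (durfee (suc a) s)
    h = P (+ suc a) * q′
    f₁ = ∑< (suc M) (durfee a s)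
    f₂ = ∑< (suc M) (durfee-rest a s)
    f≈ : f ≈ (f₁ + f₂) + x * f
    f≈ = begin
      f ≈⟨ ∑<-cong (suc M) (λ m _ → durfee-step a s m) ⟩
      ∑< (suc M) (λ m → (durfee a s m + durfee-rest a s m) + x * durfee (suc a) s m)
        ≈⟨ ∑<-+ (suc M) (λ m → durfee a s m + durfee-rest a s m) (λ m → x * durfee (suc a) s m) ⟩
      _
        ≈⟨ +-cong (∑<-+ (suc M) (durfee a s) (durfee-rest a s))
            (sym (∑<-*ˡ (suc M) x (durfee (suc a) s))) ⟩
      (f₁ + f₂) + x * f ∎
    f₁≈ : f₁ ≈ p * q
    f₁≈ = ∑-durfee a (suc M) s (ℕ.m≤n⇒m≤1+n a<M)
    f₂≈ : f₂ ≈ y * (p * q′)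
    f₂≈ = begin
      f₂                                          ≈⟨ ∑<-suc M (durfee-rest a s) ⟩
      durfee-rest a s 0 + ∑< M (λ m → durfee-rest a s (suc m))
        ≈⟨ +-cong (durfee-rest-zero a s) (∑<-cong M λ m _ → durfee-rest-suc a s m) ⟩
      0# + ∑< M (λ m → y * durfee a (suc s) m)
        ≈⟨ trans (+-identityˡ _) (sym (∑<-*ˡ M y (durfee a (suc s)))) ⟩
      y * ∑< M (durfee a (suc s))                 ≈⟨ *-congˡ (∑-durfee a M (suc s) a<M) ⟩
      y * (p * P (+ (a ℕ.+ suc s)))
        ≡⟨ ≡.cong (λ l → y * (p * P (+ l))) (ℕ.+-suc a s) ⟩
      y * (p * q′)                                ∎

  -- The conjugate Bailey pair

  conj : ℕ → ℤ → ℕ → Carrier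
  conj a r n = W (+ (n ℕ.* n ℕ.+ n)) (+ n ℤ.- r) (+ n ℤ.+ r ℤ.+ 1ℤ) * P (+ a ℤ.- + n)

  conj-neg : ∀ a {r} n → n ℕ.< r → conj a (+ r) n ≈ 0#
  conj-neg a n n<r with ℕ.m≤n⇒∃[o]m+o≡n n<r
  ... | t , ≡.refl = trans (*-congʳ (W-negˡ _ _ t (eq (+ n) (+ t)))) (zeroˡ _)
    where
    eq : ∀ n t → n ℤ.- (1ℤ ℤ.+ (n ℤ.+ t)) ≡ ℤ.- (1ℤ ℤ.+ t)
    eq = solve-∀

  -- Put n = r + m: then n² + n = (r² + r) + m(m + 2r + 1), so s = 2r + 1, and the three factors `P`
  -- are those of `durfee` regrouped.
  conj-durfee : ∀ b r m →
                conj (r ℕ.+ b) (+ r) (r ℕ.+ m) ≈ X (r ℕ.* r ℕ.+ r) * durfee b (suc (r ℕ.+ r)) m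
  conj-durfee b r m = begin
    conj (r ℕ.+ b) (+ r) (r ℕ.+ m)
      ≈⟨ *-cong (W-scale (r ℕ.* r ℕ.+ r) (m ℕ.* (m ℕ.+ s)) _ _ (≡.cong +_ (e≡ r m)))
           (reflexive (≡.cong P (b≡ (+ b) (+ r) (+ m)))) ⟩
    X (r ℕ.* r ℕ.+ r) * W e (+ (r ℕ.+ m) ℤ.- + r) (+ (r ℕ.+ m) ℤ.+ + r ℤ.+ 1ℤ) * P (+ b ℤ.- + m)
      ≈⟨ *-congʳ (*-congˡ (trans (W-cong ≡.refl (u≡ (+ r) (+ m)) (v≡ (+ r) (+ m))) (W-def _ _ _))) ⟩
    X (r ℕ.* r ℕ.+ r) * (X (m ℕ.* (m ℕ.+ s)) * (P (+ m) * P (+ (m ℕ.+ s)))) * P (+ b ℤ.- + m)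
      ≈⟨ solve 5 (λ x y u v w → x :* (y :* (u :* v)) :* w :=
            x :* (y :* (u :* w) :* v)) refl _ _ _ _ _ ⟩
    X (r ℕ.* r ℕ.+ r) * (X (m ℕ.* (m ℕ.+ s)) * (P (+ m) * P (+ b ℤ.- + m)) * P (+ (m ℕ.+ s)))
      ≈⟨ *-congˡ (*-congʳ (W-def _ _ _)) ⟨
    X (r ℕ.* r ℕ.+ r) * durfee b s m ∎
    where
    s = suc (r ℕ.+ r)
    e = + (m ℕ.* (m ℕ.+ s))
    e≡ : ∀ r m →
         (r ℕ.+ m) ℕ.* (r ℕ.+ m) ℕ.+ (r ℕ.+ m) ≡ r ℕ.* r ℕ.+ r ℕ.+ m ℕ.* (m ℕ.+ (1 ℕ.+ (r ℕ.+ r)))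
    e≡ = ℕ-Solver.solve-∀
    u≡ : ∀ r m → r ℤ.+ m ℤ.- r ≡ m
    u≡ = solve-∀
    v≡ : ∀ r m → r ℤ.+ m ℤ.+ r ℤ.+ 1ℤ ≡ m ℤ.+ (1ℤ ℤ.+ (r ℤ.+ r))
    v≡ = solve-∀
    b≡ : ∀ b r m → r ℤ.+ b ℤ.- (r ℤ.+ m) ≡ b ℤ.- m
    b≡ = solve-∀

  ∑-conj⁺ : ∀ a r →
            ∑< (suc a) (conj a (+ r)) ≈ W (+ (r ℕ.* r ℕ.+ r)) (+ a ℤ.- + r) (+ a ℤ.+ + r ℤ.+ 1ℤ)
  ∑-conj⁺ a r with ℕ.≤-<-connex r a
  -- For r > a both sides vanish: every n ≤ a lies below r, and a - r is negative.
  ... | inj₂ a<r with t , ≡.refl ← ℕ.m≤n⇒∃[o]m+o≡n a<r = trans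
    (∑<-zero (suc a) λ n n≤a → conj-neg a n (ℕ.≤-trans n≤a (ℕ.m≤m+n (suc a) t)))
    (sym (W-negˡ _ _ t (eq (+ a) (+ t))))
    where
    eq : ∀ a t → a ℤ.- (1ℤ ℤ.+ (a ℤ.+ t)) ≡ ℤ.- (1ℤ ℤ.+ t)
    eq = solve-∀
  ... | inj₁ r≤a with b , ≡.refl ← ℕ.m≤n⇒∃[o]m+o≡n r≤a = begin
    ∑< (suc (r ℕ.+ b)) (conj (r ℕ.+ b) (+ r))
      ≡⟨ ≡.cong (λ n → ∑< n (conj (r ℕ.+ b) (+ r))) (≡.sym (ℕ.+-suc r b)) ⟩
    ∑< (r ℕ.+ suc b) (conj (r ℕ.+ b) (+ r))
      ≈⟨ ∑<-dropˡ r (suc b) (conj (r ℕ.+ b) (+ r)) (conj-neg (r ℕ.+ b)) ⟩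
    ∑< (suc b) (λ m → conj (r ℕ.+ b) (+ r) (r ℕ.+ m))
      ≈⟨ ∑<-cong (suc b) (λ m _ → conj-durfee b r m) ⟩
    ∑< (suc b) (λ m → X (r ℕ.* r ℕ.+ r) * durfee b s m)
      ≈⟨ ∑<-*ˡ (suc b) (X (r ℕ.* r ℕ.+ r)) (durfee b s) ⟨
    X (r ℕ.* r ℕ.+ r) * ∑< (suc b) (durfee b s)
      ≈⟨ *-congˡ (∑-durfee b (suc b) s (ℕ.n<1+n b)) ⟩
    X (r ℕ.* r ℕ.+ r) * (P (+ b) * P (+ (b ℕ.+ s)))
      ≈⟨ W-def (+ (r ℕ.* r ℕ.+ r)) (+ b) (+ (b ℕ.+ s)) ⟨
    W (+ (r ℕ.* r ℕ.+ r)) (+ b) (+ (b ℕ.+ s))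
      ≈⟨ W-cong ≡.refl (u≡ (+ b) (+ r)) (v≡ (+ b) (+ r)) ⟩
    W (+ (r ℕ.* r ℕ.+ r)) (+ (r ℕ.+ b) ℤ.- + r) (+ (r ℕ.+ b) ℤ.+ + r ℤ.+ 1ℤ) ∎
    where
    s = suc (r ℕ.+ r)
    u≡ : ∀ b r → b ≡ r ℤ.+ b ℤ.- r
    u≡ = solve-∀
    v≡ : ∀ b r → b ℤ.+ (1ℤ ℤ.+ (r ℤ.+ r)) ≡ r ℤ.+ b ℤ.+ r ℤ.+ 1ℤ
    v≡ = solve-∀

  oblong : ∀ m → + (m ℕ.* m ℕ.+ m) ≡ + m ℤ.* + m ℤ.+ + m
  oblong m = ≡.cong (ℤ._+ + m) (ℤ.pos-* m m)

  -- Replacing r by -1 - r fixes r² + r and swaps the two indices, which reduces negative r to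
  -- `∑-conj⁺`.
  ∑-conj : ∀ a r → ∑< (suc a) (conj a r) ≈ W (r ℤ.* r ℤ.+ r) (+ a ℤ.- r) (+ a ℤ.+ r ℤ.+ 1ℤ)
  ∑-conj a (+ m)    = trans (∑-conj⁺ a m) (W-cong (oblong m) ≡.refl ≡.refl)
  ∑-conj a -[1+ m ] = begin
    ∑< (suc a) (conj a -[1+ m ])
      ≈⟨ ∑<-cong (suc a) (λ n _ → *-congʳ
          (trans (W-comm _ _ _) (W-cong ≡.refl (u≡ (+ n) (+ m)) (v≡ (+ n) (+ m))))) ⟩
    ∑< (suc a) (conj a (+ m))
      ≈⟨ ∑-conj⁺ a m ⟩
    W (+ (m ℕ.* m ℕ.+ m)) (+ a ℤ.- + m) (+ a ℤ.+ + m ℤ.+ 1ℤ)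
      ≈⟨ trans (W-comm _ _ _) (W-cong (≡.trans (oblong m) (e≡ (+ m))) (≡.sym (v≡ (+ a) (+ m)))
          (≡.sym (u≡ (+ a) (+ m)))) ⟩
    W (-[1+ m ] ℤ.* -[1+ m ] ℤ.+ -[1+ m ]) (+ a ℤ.- -[1+ m ]) (+ a ℤ.+ -[1+ m ] ℤ.+ 1ℤ) ∎
    where
    e≡ : ∀ m → m ℤ.* m ℤ.+ m ≡ (ℤ.- (1ℤ ℤ.+ m)) ℤ.* (ℤ.- (1ℤ ℤ.+ m)) ℤ.+ (ℤ.- (1ℤ ℤ.+ m))
    e≡ = solve-∀
    u≡ : ∀ n m → n ℤ.+ (ℤ.- (1ℤ ℤ.+ m)) ℤ.+ 1ℤ ≡ n ℤ.- m
    u≡ = solve-∀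
    v≡ : ∀ n m → n ℤ.- (ℤ.- (1ℤ ℤ.+ m)) ≡ n ℤ.+ m ℤ.+ 1ℤ
    v≡ = solve-∀

  -- Bailey's lemma and the finite form of the theorem

  module _ (a : ℕ) where
    bailey : Carrier → ℕ → Carrier
    bailey β n = X (n ℕ.* n ℕ.+ n) * (β * P (+ a ℤ.- + n))

    -- The conjugate pair applied to one summand of β: summing over n adds r² + r to the exponent
    -- and puts a in place of n. The equations let each family keep its own spelling of the indices.
    ∑-bailey-W : ∀ {e r e′ b c} (u v : ℕ → ℤ) → + ∣ e ∣ ≡ e →
      (∀ n → u n ≡ + n ℤ.- r) → (∀ n → v n ≡ + n ℤ.+ r ℤ.+ 1ℤ) →
      e ℤ.+ (r ℤ.* r ℤ.+ r) ≡ e′ → + a ℤ.- r ≡ b → + a ℤ.+ r ℤ.+ 1ℤ ≡ c →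
      ∑< (suc a) (λ n → bailey (W e (u n) (v n)) n) ≈ W e′ b c
    ∑-bailey-W {e} {r} u v e≥0 u≡ v≡ ≡.refl ≡.refl ≡.refl = begin
      ∑< (suc a) (λ n → bailey (W e (u n) (v n)) n)
        ≈⟨ ∑<-cong (suc a) (λ n _ → step n) ⟩
      ∑< (suc a) (λ n → X ∣ e ∣ * conj a r n)
        ≈⟨ ∑<-*ˡ (suc a) (X ∣ e ∣) (conj a r) ⟨
      X ∣ e ∣ * ∑< (suc a) (conj a r)
        ≈⟨ *-congˡ (trans (∑-conj a r) (W-cong (≡.sym (oblong-nonneg r)) ≡.refl ≡.refl)) ⟩
      X ∣ e ∣ * W (+ ∣ r ℤ.* r ℤ.+ r ∣) (+ a ℤ.- r) (+ a ℤ.+ r ℤ.+ 1ℤ)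
        ≈⟨ W-scale ∣ e ∣ ∣ r ℤ.* r ℤ.+ r ∣ _ _
            (≡.cong₂ ℤ._+_ (≡.sym e≥0) (≡.sym (oblong-nonneg r))) ⟨
      W (e ℤ.+ (r ℤ.* r ℤ.+ r)) (+ a ℤ.- r) (+ a ℤ.+ r ℤ.+ 1ℤ) ∎
      where
      step : ∀ n → bailey (W e (u n) (v n)) n ≈ X ∣ e ∣ * conj a r n
      step n = begin
        X N * (W e (u n) (v n) * p)
          ≈⟨ *-congˡ (*-congʳ (trans (W-cong ≡.refl (u≡ n) (v≡ n)) (W-def e _ _))) ⟩
        X N * (X ∣ e ∣ * pp * p)
          ≈⟨ solve 4 (λ x y z w → x :* (y :* z :* w) := y :* (x :* z :* w)) refl _ _ _ _ ⟩
        X ∣ e ∣ * (X N * pp * p)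
          ≈⟨ *-congˡ (*-congʳ (W-def _ _ _)) ⟨
        X ∣ e ∣ * conj a r n ∎
        where
        N = n ℕ.* n ℕ.+ n
        p = P (+ a ℤ.- + n)
        pp = P (+ n ℤ.- r) * P (+ n ℤ.+ r ℤ.+ 1ℤ)

    -- The exponents of the theorem arise as a₁(k) + r² + r at r = -3k and as a₂(k) + r² + r at r =
    -- 3k + 1.
    theta₁ theta₂ : ℤ → Carrier
    theta₁ k = W (+ 15 ℤ.* (k ℤ.* k) ℤ.- + 4 ℤ.* k) (+ a ℤ.+ + 3 ℤ.* k) (+ a ℤ.- + 3 ℤ.* k ℤ.+ 1ℤ)
    theta₂ k = W (+ 15 ℤ.* (k ℤ.* k) ℤ.+ + 14 ℤ.* k ℤ.+ + 3)
                 (+ a ℤ.- + 3 ℤ.* k ℤ.- 1ℤ) (+ a ℤ.+ + 3 ℤ.* k ℤ.+ + 2)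

    ∑-bailey-odd₁ : ∀ k → ∑< (suc a) (λ n → bailey (odd₁ (+ n) k) n) ≈ theta₁ k
    ∑-bailey-odd₁ k = ∑-bailey-W {r = ℤ.- (+ 3 ℤ.* k)}
      (λ n → + n ℤ.+ + 3 ℤ.* k) (λ n → + n ℤ.- + 3 ℤ.* k ℤ.+ 1ℤ) (a₁-nonneg k)
      (λ n → u≡ (+ n) k) (λ n → ≡.refl) (e≡ k) (≡.sym (u≡ (+ a) k)) ≡.refl
      where
      u≡ : ∀ n k → n ℤ.+ + 3 ℤ.* k ≡ n ℤ.- (ℤ.- (+ 3 ℤ.* k))
      u≡ = solve-∀
      e≡ : ∀ k →
           + 6 ℤ.* (k ℤ.* k) ℤ.- k ℤ.+ ((ℤ.- (+ 3 ℤ.* k)) ℤ.* (ℤ.- (+ 3 ℤ.* k)) ℤ.+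
               (ℤ.- (+ 3 ℤ.* k)))
               ≡ + 15 ℤ.* (k ℤ.* k) ℤ.- + 4 ℤ.* k
      e≡ = solve-∀

    ∑-bailey-odd₂ : ∀ k → ∑< (suc a) (λ n → bailey (odd₂ (+ n) k) n) ≈ theta₂ k
    ∑-bailey-odd₂ k = ∑-bailey-W {r = + 3 ℤ.* k ℤ.+ 1ℤ}
      (λ n → + n ℤ.- + 3 ℤ.* k ℤ.- 1ℤ) (λ n → + n ℤ.+ + 3 ℤ.* k ℤ.+ + 2) (a₂-nonneg k)
      (λ n → u≡ (+ n) k) (λ n → v≡ (+ n) k) (e≡ k) (≡.sym (u≡ (+ a) k)) (≡.sym (v≡ (+ a) k))
      where
      u≡ : ∀ n k → n ℤ.- + 3 ℤ.* k ℤ.- 1ℤ ≡ n ℤ.- (+ 3 ℤ.* k ℤ.+ 1ℤ)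
      u≡ = solve-∀
      v≡ : ∀ n k → n ℤ.+ + 3 ℤ.* k ℤ.+ + 2 ≡ n ℤ.+ (+ 3 ℤ.* k ℤ.+ 1ℤ) ℤ.+ 1ℤ
      v≡ = solve-∀
      e≡ : ∀ k →
           + 6 ℤ.* (k ℤ.* k) ℤ.+ + 5 ℤ.* k ℤ.+ 1ℤ ℤ.+
               ((+ 3 ℤ.* k ℤ.+ 1ℤ) ℤ.* (+ 3 ℤ.* k ℤ.+ 1ℤ) ℤ.+ (+ 3 ℤ.* k ℤ.+ 1ℤ))
               ≡ + 15 ℤ.* (k ℤ.* k) ℤ.+ + 14 ℤ.* k ℤ.+ + 3
      e≡ = solve-∀

    bailey-∑± : ∀ K f n → bailey (∑± K f) n ≈ ∑± K (λ k → bailey (f k) n)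
    bailey-∑± K f n = begin
      X N * (∑± K f * p)
        ≈⟨ solve 3 (λ x y z → x :* (y :* z) := x :* z :* y) refl _ _ _ ⟩
      X N * p * ∑± K f               ≈⟨ ∑±-*ˡ K (X N * p) f ⟩
      ∑± K (λ k → X N * p * f k)
        ≈⟨ ∑±-cong K (λ k → solve 3 (λ x y z → x :* z :* y := x :* (y :* z)) refl (X N) (f k) p) ⟩
      ∑± K (λ k → bailey (f k) n)    ∎
      where
      N = n ℕ.* n ℕ.+ n
      p = P (+ a ℤ.- + n)

    ∑-bailey-∑± : ∀ K (f : ℕ → ℤ → Carrier) {t} →
                  (∀ k → ∑< (suc a) (λ n → bailey (f n k) n) ≈ t k) →
                  ∑< (suc a) (λ n → bailey (∑± K (f n)) n) ≈ ∑± K t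
    ∑-bailey-∑± K f {t} f≈t = begin
      ∑< (suc a) (λ n → bailey (∑± K (f n)) n)
        ≈⟨ ∑<-cong (suc a) (λ n _ → bailey-∑± K (f n) n) ⟩
      ∑< (suc a) (λ n → ∑± K (λ k → bailey (f n k) n))
        ≈⟨ ∑<-∑±-comm (suc a) K (λ n k → bailey (f n k) n) ⟩
      ∑± K (λ k → ∑< (suc a) (λ n → bailey (f n k) n))    ≈⟨ ∑±-cong K f≈t ⟩
      ∑± K t                                              ∎

    -- Weight `odd` by `bailey`, sum over n ≤ a and exchange the sums over n and k; the window
    -- `suc a` exceeds every such n.
    finite-identity : ∑± (suc a) theta₁ ≈
                      ∑± (suc a) theta₂ + ∑< (suc a) (λ n → bailey (P (+ suc (n ℕ.+ n))) n)
    finite-identity = begin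
      ∑± K theta₁
        ≈⟨ ∑-bailey-∑± K (λ n → odd₁ (+ n)) ∑-bailey-odd₁ ⟨
      ∑< K (λ n → bailey (∑± K (odd₁ (+ n))) n)
        ≈⟨ ∑<-cong K (λ n n<K → trans (*-congˡ (*-congʳ (odd K n n<K)))
             (solve 4 (λ x y z w → x :* ((y :+ z) :* w) :=
                   x :* (y :* w) :+ x :* (z :* w)) refl _ _ _ _)) ⟩
      ∑< K (λ n → bailey (∑± K (odd₂ (+ n))) n + bailey (P (+ suc (n ℕ.+ n))) n)
        ≈⟨ ∑<-+ K (λ n → bailey (∑± K (odd₂ (+ n))) n) (λ n → bailey (P (+ suc (n ℕ.+ n))) n) ⟩
      ∑< K (λ n → bailey (∑± K (odd₂ (+ n))) n) + ∑< K (λ n → bailey (P (+ suc (n ℕ.+ n))) n)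
        ≈⟨ +-congʳ (∑-bailey-∑± K (λ n → odd₂ (+ n)) ∑-bailey-odd₂) ⟩
      ∑± K theta₂ + ∑< K (λ n → bailey (P (+ suc (n ℕ.+ n))) n) ∎
      where K = suc a

open import Defs
open import Algebra.Properties.Semiring.Sum ℤ.+-*-semiring
  using (sum-cong-≗; sum-replicate-zero; ∑-distrib-+)
open import Algebra.Properties.Ring ℤ.+-*-ring using (+-cancelʳ)

-- Formal power series

infixl 6 _⊕_
infixr 7 _⊙_
infix 8 ⊝_

_⊕_ : FPS → FPS → FPS
(a ⊕ b) N = a N ℤ.+ b N

⊝_ : FPS → FPS
(⊝ a) N = ℤ.- a N

0ₛ : FPS
0ₛ N = 0ℤ

tail : FPS → FPS
tail a N = a (suc N)

≈-isEquivalence : IsEquivalence _≈_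
≈-isEquivalence = record
  { refl  = λ N → ≡.refl
  ; sym   = λ eq N → ≡.sym (eq N)
  ; trans = λ p q N → ≡.trans (p N) (q N)
  }

infix 4 _≈[_]_
-- Congruence modulo q^(N+1).
_≈[_]_ : FPS → ℕ → FPS → Set
a ≈[ N ] b = ∀ n → n ℕ.≤ N → a n ≡ b n

·-cong-mod : ∀ {N a a′ b b′} → a ≈[ N ] a′ → b ≈[ N ] b′ → a · b ≈[ N ] a′ · b′
·-cong-mod a≈ b≈ n n≤N = sum-cong-≗ {suc n} λ i → cong₂ ℤ._*_
  (a≈ (toℕ i) (ℕ.≤-trans (Fin.toℕ≤pred[n] i) n≤N))
  (b≈ (n ∸ toℕ i) (ℕ.≤-trans (ℕ.m∸n≤m n (toℕ i)) n≤N))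

·-cong : ∀ {a a′ b b′} → a ≈ a′ → b ≈ b′ → a · b ≈ a′ · b′
·-cong a≈ b≈ N = ·-cong-mod {N} (λ n _ → a≈ n) (λ n _ → b≈ n) N ℕ.≤-refl

·-zeroˡ : ∀ a → 0ₛ · a ≈ 0ₛ
·-zeroˡ a N = ≡.trans (sum-cong-≗ {suc N} λ i → ℤ.*-zeroˡ (a (N ∸ toℕ i)))
    (sum-replicate-zero (suc N))

-- The mirror image of the computation rule of `_·_`, which peels off `a 0`; comparing the two gives
-- commutativity by induction on the coefficient.
·-sucʳ : ∀ a b N → (a · b) (suc N) ≡ (a · tail b) N ℤ.+ a (suc N) ℤ.* b 0
·-sucʳ a b zero    = eq (a 0 ℤ.* b 1) (a 1 ℤ.* b 0)
  where
  eq : ∀ x y → x ℤ.+ (y ℤ.+ 0ℤ) ≡ x ℤ.+ 0ℤ ℤ.+ y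
  eq = solve-∀
·-sucʳ a b (suc N) = ≡.trans (cong (λ z → a 0 ℤ.* b (suc (suc N)) ℤ.+ z) (·-sucʳ (tail a) b N))
  (≡.sym (ℤ.+-assoc (a 0 ℤ.* b (suc (suc N))) _ _))

·-comm : ∀ a b → a · b ≈ b · a
·-comm a b zero    = cong (ℤ._+ 0ℤ) (ℤ.*-comm (a 0) (b 0))
·-comm a b (suc N) = ≡.trans (·-sucʳ a b N) (≡.trans
  (cong₂ ℤ._+_ (·-comm a (tail b) N) (ℤ.*-comm (a (suc N)) (b 0)))
  (ℤ.+-comm _ (b 0 ℤ.* a (suc N))))

·-distribʳ : ∀ c a b → (a ⊕ b) · c ≈ (a · c) ⊕ (b · c)
·-distribʳ c a b N = ≡.trans
  (sum-cong-≗ {suc N} λ i → ℤ.*-distribʳ-+ (c (N ∸ toℕ i)) (a (toℕ i)) (b (toℕ i)))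
  (∑-distrib-+ {suc N} (λ i → a (toℕ i) ℤ.* c (N ∸ toℕ i)) (λ i → b (toℕ i) ℤ.* c (N ∸ toℕ i)))

·-distribˡ : ∀ c a b → c · (a ⊕ b) ≈ (c · a) ⊕ (c · b)
·-distribˡ c a b N = ≡.trans (·-comm c (a ⊕ b) N)
  (≡.trans (·-distribʳ c a b N) (cong₂ ℤ._+_ (·-comm a c N) (·-comm b c N)))

_⊙_ : ℤ → FPS → FPS
(z ⊙ a) N = z ℤ.* a N

⊙-·-assoc : ∀ z a b → (z ⊙ a) · b ≈ z ⊙ (a · b)
⊙-·-assoc z a b zero    = eq z (a 0) (b 0)
  where
  eq : ∀ z x y → z ℤ.* x ℤ.* y ℤ.+ 0ℤ ≡ z ℤ.* (x ℤ.* y ℤ.+ 0ℤ)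
  eq = solve-∀
⊙-·-assoc z a b (suc N) = ≡.trans (cong (λ t → z ℤ.* a 0 ℤ.* b (suc N) ℤ.+ t)
    (⊙-·-assoc z (tail a) b N))
  (eq z (a 0) (b (suc N)) ((tail a · b) N))
  where
  eq : ∀ z x y t → z ℤ.* x ℤ.* y ℤ.+ z ℤ.* t ≡ z ℤ.* (x ℤ.* y ℤ.+ t)
  eq = solve-∀

·-assoc : ∀ a b c → (a · b) · c ≈ a · (b · c)
·-assoc a b c zero    = eq (a 0) (b 0) (c 0)
  where
  eq : ∀ x y z → (x ℤ.* y ℤ.+ 0ℤ) ℤ.* z ℤ.+ 0ℤ ≡ x ℤ.* (y ℤ.* z ℤ.+ 0ℤ) ℤ.+ 0ℤ
  eq = solve-∀
·-assoc a b c (suc N) = begin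
  (a · b) 0 ℤ.* c (suc N) ℤ.+ (tail (a · b) · c) N
    -- By computation `tail (a · b)` is `(a 0 ⊙ tail b) ⊕ (tail a · b)`.
    ≡⟨ cong (λ t → (a · b) 0 ℤ.* c (suc N) ℤ.+ t)
        (≡.trans (·-distribʳ c (a 0 ⊙ tail b) (tail a · b) N)
         (cong₂ ℤ._+_ (⊙-·-assoc (a 0) (tail b) c N) (·-assoc (tail a) b c N))) ⟩
  (a · b) 0 ℤ.* c (suc N) ℤ.+ (a 0 ℤ.* (tail b · c) N ℤ.+ (tail a · (b · c)) N)
    ≡⟨ eq (a 0) (b 0) (c (suc N)) ((tail b · c) N) ((tail a · (b · c)) N) ⟩
  a 0 ℤ.* (b 0 ℤ.* c (suc N) ℤ.+ (tail b · c) N) ℤ.+ (tail a · (b · c)) N ∎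
  where
  open ≡.≡-Reasoning
  eq : ∀ x y z s t → (x ℤ.* y ℤ.+ 0ℤ) ℤ.* z ℤ.+ (x ℤ.* s ℤ.+ t) ≡ x ℤ.* (y ℤ.* z ℤ.+ s) ℤ.+ t
  eq = solve-∀

·-identityˡ : ∀ a → 1ₛ · a ≈ a
·-identityˡ a N = ≡.trans (·-comm 1ₛ a N) (·-identityʳ a N)

FPS-commutativeRing : CommutativeRing 0ℓ 0ℓ
FPS-commutativeRing = record
  { Carrier = FPS ; _≈_ = _≈_ ; _+_ = _⊕_ ; _*_ = _·_ ; -_ = ⊝_ ; 0# = 0ₛ ; 1# = 1ₛ
  ; isCommutativeRing = record
    { isRing = record
      { +-isAbelianGroup = record
        { isGroup = record
          { isMonoid = record
            { isSemigroup = record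
              { isMagma = record
                { isEquivalence = ≈-isEquivalence
                ; ∙-cong = λ p q N → cong₂ ℤ._+_ (p N) (q N)
                }
              ; assoc = λ a b c N → ℤ.+-assoc (a N) (b N) (c N)
              }
            ; identity = (λ a N → ℤ.+-identityˡ (a N)) , (λ a N → ℤ.+-identityʳ (a N))
            }
          ; inverse = (λ a N → ℤ.+-inverseˡ (a N)) , (λ a N → ℤ.+-inverseʳ (a N))
          ; ⁻¹-cong = λ p N → cong ℤ.-_ (p N)
          }
        ; comm = λ a b N → ℤ.+-comm (a N) (b N)
        }
      ; *-cong = λ {a} {a′} {b} {b′} → ·-cong {a} {a′} {b} {b′}
      ; *-assoc = ·-assoc
      ; *-identity = ·-identityˡ , ·-identityʳ
      ; distrib = ·-distribˡ , ·-distribʳ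
      }
    ; *-comm = ·-comm
    }
  }

open Summation FPS-commutativeRing
open Units FPS-commutativeRing
open Algebra.Solver.Ring.NaturalCoefficients.Default
  (CommutativeRing.commutativeSemiring FPS-commutativeRing) using (solve; _:+_; _:*_; _:=_)

-- Powers of q and the series 1/(q;q)ₙ as a `QSystem`

q^-+ : ∀ m n → q^ (m ℕ.+ n) ≈ q^ m · q^ n
q^-+ zero    n N       = ≡.sym (·-identityˡ (q^ n) N)
q^-+ (suc m) n zero    = ≡.refl
q^-+ (suc m) n (suc N) = ≡.trans (q^-+ m n N) (≡.sym (ℤ.+-identityˡ _))

-- Coefficient i+1 of qⁿ⁺¹ y involves only coefficients of y up to i, so all coefficients vanish by
-- strong induction.
q^-cancel : ∀ n y → y ≈ q^ (suc n) · y → y ≈ 0ₛ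
q^-cancel n y y≈ N = vanish N N ℕ.≤-refl
  where
  vanish : ∀ N → y ≈[ N ] 0ₛ
  vanish N       zero    _         = y≈ 0
  vanish (suc N) (suc i) (s≤s i≤N) = ≡.trans (y≈ (suc i)) (≡.trans
    (ℤ.+-identityˡ _)
    (≡.trans (·-cong-mod {N} {q^ n} {q^ n} {y} {0ₛ} (λ _ _ → ≡.refl) (vanish N) i i≤N)
      (≡.trans (·-comm (q^ n) 0ₛ i) (·-zeroˡ (q^ n) i))))

1/qPoch : ℤ → FPS
1/qPoch (+ n)    = 1/ qPoch n
1/qPoch -[1+ n ] = 0ₛ

qPoch-inverse : ∀ n → qPoch n · 1/qPoch (+ n) ≈ 1ₛ
qPoch-inverse n = 1/-inverseʳ (qPoch n) (qPoch-constant n)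

FPS-QSystem : QSystem FPS-commutativeRing
FPS-QSystem = record
  { X        = q^_
  ; X-zero   = λ N → ≡.refl
  ; X-+      = q^-+
  ; X-cancel = q^-cancel
  ; P        = 1/qPoch
  ; P-neg    = λ n N → ≡.refl
  ; P-zero   = λ N → ≡.trans (≡.sym (·-identityˡ (1/ 1ₛ) N)) (qPoch-inverse 0 N)
  ; P-suc    = λ n → inverse-step {qPoch n} {qPoch (suc n)} {1/qPoch (+ n)} {1/qPoch (+ suc n)}
                 (q^ (suc n)) (λ N → ≡.refl) (qPoch-inverse n) (qPoch-inverse (suc n))
  }

-- Coefficients of finite and infinite sums

module ℤΣ = Summation ℤ.+-*-commutativeRing

∑<-coeff : ∀ n f N → ∑< n f N ≡ ℤΣ.∑< n (λ i → f i N)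
∑<-coeff zero    f N = ≡.trans (∑<-zero 0 {f} (λ _ ()) N)
    (≡.sym (ℤΣ.∑<-zero 0 {λ i → f i N} λ _ ()))
∑<-coeff (suc n) f N = ≡.trans (∑<-suc n f N) (≡.trans
  (cong (λ z → f 0 N ℤ.+ z) (∑<-coeff n (λ i → f (suc i)) N)) (≡.sym (ℤΣ.∑<-suc n (λ i → f i N))))

∑±-coeff : ∀ K f N → ∑± K f N ≡ ℤΣ.∑± K (λ k → f k N)
∑±-coeff K f N = cong₂ ℤ._+_ (∑<-coeff K (λ m → f (+ m)) N) (∑<-coeff K (λ m → f -[1+ m ]) N)

foldr-applyUpTo : ∀ {I : Set} (f : I → ℤ) (g : ℕ → I) n z →
                  foldr (λ i c → f i ℤ.+ c) z (applyUpTo g n) ≡ ℤΣ.∑< n (λ i → f (g i)) ℤ.+ z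
foldr-applyUpTo f g zero    z = ≡.sym (≡.trans
  (cong (ℤ._+ z) (ℤΣ.∑<-zero 0 {λ i → f (g i)} λ _ ())) (ℤ.+-identityˡ z))
foldr-applyUpTo f g (suc n) z = ≡.trans
  (cong (λ y → f (g 0) ℤ.+ y) (foldr-applyUpTo f (λ i → g (suc i)) n z))
  (≡.trans (≡.sym (ℤ.+-assoc (f (g 0)) _ z)) (cong (ℤ._+ z) (≡.sym (ℤΣ.∑<-suc n (λ i → f (g i))))))

foldr-upTo : ∀ f n → foldr (λ i c → f i ℤ.+ c) 0ℤ (upTo n) ≡ ℤΣ.∑< n f
foldr-upTo f n = ≡.trans (foldr-applyUpTo f id n 0ℤ) (ℤ.+-identityʳ _)

foldr-ℤ-range : ∀ f N → foldr (λ i c → f i ℤ.+ c) 0ℤ (ℤ-range N) ≡ ℤΣ.∑± (suc N) f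
foldr-ℤ-range f N = begin
  foldr h 0ℤ (map +_ (upTo K) ++ map -[1+_] (upTo K))
    ≡⟨ List.foldr-++ h 0ℤ (map +_ (upTo K)) (map -[1+_] (upTo K)) ⟩
  foldr h (foldr h 0ℤ (map -[1+_] (upTo K))) (map +_ (upTo K))
    ≡⟨ cong₂ (foldr h) (cong (foldr h 0ℤ) (List.map-upTo -[1+_] K)) (List.map-upTo +_ K) ⟩
  foldr h (foldr h 0ℤ (applyUpTo -[1+_] K)) (applyUpTo +_ K)
    ≡⟨ foldr-applyUpTo f +_ K _ ⟩
  ℤΣ.∑< K (λ m → f (+ m)) ℤ.+ foldr h 0ℤ (applyUpTo -[1+_] K)
    ≡⟨ cong (λ z → ℤΣ.∑< K (λ m → f (+ m)) ℤ.+ z)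
        (≡.trans (foldr-applyUpTo f -[1+_] K 0ℤ) (ℤ.+-identityʳ _)) ⟩
  ℤΣ.∑± K f ∎
  where
  open ≡.≡-Reasoning
  K = suc N
  h : ℤ → ℤ → ℤ
  h i c = f i ℤ.+ c

-- `∑` truncates at a point that depends on the coefficient. One K serves all coefficients up to N,
-- the extra terms being zero there because term i starts at q^(i²+i).
∑-lhs : ∀ {N K} → N ℕ.< K → ∑ lhsTerm lhs-summable ≈[ N ] ∑< K lhsTerm
∑-lhs {N} {K} N<K n n≤N = begin
  foldr (λ i c → lhsTerm i n ℤ.+ c) 0ℤ (upTo (suc n))  ≡⟨ foldr-upTo (λ i → lhsTerm i n) (suc n) ⟩
  ℤΣ.∑< (suc n) (λ i → lhsTerm i n)
    ≡⟨ ℤΣ.∑<-dropʳ (λ i → lhsTerm i n) (ℕ.≤-trans (s≤s n≤N) N<K)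
         (λ i n<i → q^·-below (1/ qPoch (2 ℕ.* i ℕ.+ 1)) (ℕ.≤-trans n<i (ℕ.m≤n+m i (i ℕ.^ 2)))) ⟨
  ℤΣ.∑< K (λ i → lhsTerm i n)                          ≡⟨ ∑<-coeff K lhsTerm n ⟨
  ∑< K lhsTerm n                                       ∎
  where open ≡.≡-Reasoning

rhsTerm-below : ∀ k {n} → n ℕ.< ∣ k ∣ → rhsTerm k n ≡ 0ℤ
rhsTerm-below k n<k = cong₂ ℤ._-_ (q^-below (ℕ.<-≤-trans n<k (e₁-≥ k)))
    (q^-below (ℕ.<-≤-trans n<k (e₂-≥ k)))

∑-rhs : ∀ {N K} → N ℕ.< K → ∑ rhsTerm rhs-summable ≈[ N ] ∑± K rhsTerm
∑-rhs {N} {K} N<K n n≤N = begin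
  foldr (λ k c → rhsTerm k n ℤ.+ c) 0ℤ (ℤ-range n)      ≡⟨ foldr-ℤ-range (λ k → rhsTerm k n) n ⟩
  ℤΣ.∑± (suc n) (λ k → rhsTerm k n)
    ≡⟨ cong₂ ℤ._+_
        (ℤΣ.∑<-dropʳ (λ m → rhsTerm (+ m) n) n<K (λ m n<m → rhsTerm-below (+ m) n<m))
        (ℤΣ.∑<-dropʳ (λ m → rhsTerm -[1+ m ] n) n<K
            (λ m n<m → rhsTerm-below -[1+ m ] (ℕ.m≤n⇒m≤1+n n<m))) ⟨
  ℤΣ.∑± K (λ k → rhsTerm k n)                           ≡⟨ ∑±-coeff K rhsTerm n ⟨
  ∑± K rhsTerm n                                        ∎
  where
  open ≡.≡-Reasoning
  n<K = ℕ.≤-trans (s≤s n≤N) N<K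

∑<-cong-mod : ∀ N n {f g} → (∀ i → f i ≈[ N ] g i) → ∑< n f ≈[ N ] ∑< n g
∑<-cong-mod N n {f} {g} f≈g i i≤N = ≡.trans (∑<-coeff n f i) (≡.trans
  (ℤΣ.∑<-cong n (λ j _ → f≈g j i i≤N)) (≡.sym (∑<-coeff n g i)))

∑±-cong-mod : ∀ N K {f g} → (∀ k → f k ≈[ N ] g k) → ∑± K f ≈[ N ] ∑± K g
∑±-cong-mod N K f≈g i i≤N = cong₂ ℤ._+_
  (∑<-cong-mod N K (λ m → f≈g (+ m)) i i≤N) (∑<-cong-mod N K (λ m → f≈g -[1+ m ]) i i≤N)

P∞ : FPS
P∞ = 1/ qPoch∞

qPoch∞-inverse : qPoch∞ · P∞ ≈ 1ₛ
qPoch∞-inverse = 1/-inverseʳ qPoch∞ qPoch∞-constant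

-- Congruence passes to inverses: in p = p (q;q)∞ P∞ the factor (q;q)∞ may be replaced by (q;q)ₙ,
-- which cancels p and leaves P∞.
1/qPoch-limit : ∀ {N n} → N ℕ.≤ n → 1/qPoch (+ n) ≈[ N ] P∞
1/qPoch-limit {N} {n} N≤n i i≤N = begin
  p i
    ≡⟨ inverse-swap {qPoch n} {qPoch∞} {p} {P∞} (qPoch-inverse n) qPoch∞-inverse i ⟩
  (p · (qPoch∞ · P∞)) i  ≡⟨ ·-cong-mod {N} {p} {p} {qPoch∞ · P∞} {qPoch n · P∞} (λ _ _ → ≡.refl)
                              (·-cong-mod {N} {qPoch∞} {qPoch n} {P∞} {P∞} q≈
                                  (λ _ _ → ≡.refl)) i i≤N ⟩
  (p · (qPoch n · P∞)) i
    ≡⟨ solve 3 (λ p q r → p :* (q :* r) := r :* (q :* p)) (λ _ → ≡.refl) p (qPoch n) P∞ i ⟩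
  (P∞ · (qPoch n · p)) i
    ≡⟨ inverse-swap {qPoch∞} {qPoch n} {P∞} {p} qPoch∞-inverse (qPoch-inverse n) i ⟨
  P∞ i                   ∎
  where
  open ≡.≡-Reasoning
  p = 1/qPoch (+ n)
  q≈ : qPoch∞ ≈[ N ] qPoch n
  q≈ j j≤N = ≡.sym (qPoch-stable j n (ℕ.≤-trans j≤N N≤n))

open FiniteIdentity FPS-QSystem using (W-def; theta₁; theta₂; bailey; finite-identity)

-- Passage to the limit

-- For e > N both sides vanish up to qᴺ. The hypothesis e ≤ N is what bounds k in the theta limits,
-- through `e₁-≥` and `e₂-≥`, and n in `bailey-limit`.
q^·-cong-mod : ∀ {N} e a b → (e ℕ.≤ N → a ≈[ N ] b) → q^ e · a ≈[ N ] q^ e · b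
q^·-cong-mod {N} e a b a≈b i i≤N with ℕ.≤-<-connex e N
... | inj₁ e≤N = ·-cong-mod {N} {q^ e} {q^ e} {a} {b} (λ _ _ → ≡.refl) (a≈b e≤N) i i≤N
... | inj₂ N<e = ≡.trans (q^·-below a (ℕ.≤-<-trans i≤N N<e))
    (≡.sym (q^·-below b (ℕ.≤-<-trans i≤N N<e)))

module Limit (N : ℕ) where
  -- With a = 4N + 2, every index a + (± 3k + c) with ∣k∣ ≤ N and ∣c∣ ≤ 2 is at
  -- least N, so the factors 1/(q;q) of the finite identity agree with 1/(q;q)∞
  -- modulo q^(N+1).
  D a K : ℕ
  D = 3 ℕ.* N ℕ.+ 2
  a = N ℕ.+ D
  K = suc a

  N<K : N ℕ.< K
  N<K = s≤s (ℕ.m≤m+n N D)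

  P-limit : ∀ {u} j → u ≡ + a ℤ.+ j → ∣ j ∣ ℕ.≤ D → 1/qPoch u ≈[ N ] P∞
  P-limit (+ i)    ≡.refl _   = 1/qPoch-limit (ℕ.≤-trans (ℕ.m≤m+n N D) (ℕ.m≤m+n a i))
  P-limit -[1+ i ] ≡.refl i<D rewrite ℤ.⊖-≥ (ℕ.≤-trans i<D (ℕ.m≤n+m D N)) =
    1/qPoch-limit (ℕ.≤-trans (ℕ.≤-reflexive (≡.sym (ℕ.m+n∸n≡m N D))) (ℕ.∸-monoʳ-≤ a i<D))

  ∣3k+c∣≤D : ∀ k c → ∣ k ∣ ℕ.≤ N → ∣ c ∣ ℕ.≤ 2 → ∣ + 3 ℤ.* k ℤ.+ c ∣ ℕ.≤ D
  ∣3k+c∣≤D k c k≤N c≤2 = ℕ.≤-trans (ℤ.∣i+j∣≤∣i∣+∣j∣ (+ 3 ℤ.* k) c)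
    (ℕ.+-mono-≤ (ℕ.≤-trans (ℕ.≤-reflexive (ℤ.abs-* (+ 3) k)) (ℕ.*-monoʳ-≤ 3 k≤N)) c≤2)

  P²-limit : ∀ {u v} i j c d → u ≡ + a ℤ.+ (+ 3 ℤ.* i ℤ.+ c) → v ≡ + a ℤ.+ (+ 3 ℤ.* j ℤ.+ d) →
             ∣ c ∣ ℕ.≤ 2 → ∣ d ∣ ℕ.≤ 2 → ∣ i ∣ ℕ.≤ N → ∣ j ∣ ℕ.≤ N →
             1/qPoch u · 1/qPoch v ≈[ N ] P∞ · P∞
  P²-limit {u} {v} i j c d u≡ v≡ c≤2 d≤2 i≤N j≤N =
    ·-cong-mod {N} {1/qPoch u} {P∞} {1/qPoch v} {P∞}
      (P-limit (+ 3 ℤ.* i ℤ.+ c) u≡ (∣3k+c∣≤D i c i≤N c≤2))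
          (P-limit (+ 3 ℤ.* j ℤ.+ d) v≡ (∣3k+c∣≤D j d j≤N d≤2))

  theta₁-limit : ∀ k → theta₁ a k ≈[ N ] P∞ · P∞ · q^ ∣ e₁ k ∣
  theta₁-limit k i i≤N = ≡.trans (W-def _ u v i) (≡.trans
    (q^·-cong-mod {N} ∣ e₁ k ∣ (1/qPoch u · 1/qPoch v) (P∞ · P∞) (λ e≤N →
       P²-limit k (ℤ.- k) 0ℤ 1ℤ (u≡ (+ a) k) (v≡ (+ a) k) z≤n (s≤s z≤n)
         (ℕ.≤-trans (e₁-≥ k) e≤N)
         (ℕ.≤-trans (ℕ.≤-reflexive (ℤ.∣-i∣≡∣i∣ k)) (ℕ.≤-trans (e₁-≥ k) e≤N))) i i≤N)
    (·-comm (q^ ∣ e₁ k ∣) (P∞ · P∞) i))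
    where
    u v : ℤ
    u = + a ℤ.+ + 3 ℤ.* k
    v = + a ℤ.- + 3 ℤ.* k ℤ.+ 1ℤ
    u≡ : ∀ a k → a ℤ.+ + 3 ℤ.* k ≡ a ℤ.+ (+ 3 ℤ.* k ℤ.+ 0ℤ)
    u≡ = solve-∀
    v≡ : ∀ a k → a ℤ.- + 3 ℤ.* k ℤ.+ 1ℤ ≡ a ℤ.+ (+ 3 ℤ.* (ℤ.- k) ℤ.+ 1ℤ)
    v≡ = solve-∀

  theta₂-limit : ∀ k → theta₂ a k ≈[ N ] P∞ · P∞ · q^ ∣ e₂ k ∣
  theta₂-limit k i i≤N = ≡.trans (W-def _ u v i) (≡.trans
    (q^·-cong-mod {N} ∣ e₂ k ∣ (1/qPoch u · 1/qPoch v) (P∞ · P∞) (λ e≤N →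
       P²-limit (ℤ.- k) k (ℤ.- 1ℤ) (+ 2) (u≡ (+ a) k) (v≡ (+ a) k) (s≤s z≤n) (s≤s (s≤s z≤n))
         (ℕ.≤-trans (ℕ.≤-reflexive (ℤ.∣-i∣≡∣i∣ k)) (ℕ.≤-trans (e₂-≥ k) e≤N))
         (ℕ.≤-trans (e₂-≥ k) e≤N)) i i≤N)
    (·-comm (q^ ∣ e₂ k ∣) (P∞ · P∞) i))
    where
    u v : ℤ
    u = + a ℤ.- + 3 ℤ.* k ℤ.- 1ℤ
    v = + a ℤ.+ + 3 ℤ.* k ℤ.+ + 2
    u≡ : ∀ a k → a ℤ.- + 3 ℤ.* k ℤ.- 1ℤ ≡ a ℤ.+ (+ 3 ℤ.* (ℤ.- k) ℤ.+ (ℤ.- 1ℤ))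
    u≡ = solve-∀
    v≡ : ∀ a k → a ℤ.+ + 3 ℤ.* k ℤ.+ + 2 ≡ a ℤ.+ (+ 3 ℤ.* k ℤ.+ + 2)
    v≡ = solve-∀

  bailey-limit : ∀ n → bailey a (1/qPoch (+ suc (n ℕ.+ n))) n ≈[ N ] P∞ · lhsTerm n
  bailey-limit n i i≤N = begin
    (q^ e · (p · p′)) i
      ≡⟨ q^·-cong-mod {N} e (p · p′) (p · P∞)
          (λ e≤N → ·-cong-mod {N} {p} {p} {p′} {P∞} (λ _ _ → ≡.refl)
           (P-limit (ℤ.- + n) ≡.refl (n≤D e≤N))) i i≤N ⟩
    (q^ e · (p · P∞)) i
      ≡⟨ solve 3 (λ x y z → x :* (y :* z) := z :* (x :* y)) (λ _ → ≡.refl) (q^ e) p P∞ i ⟩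
    (P∞ · (q^ e · p)) i
      -- `n ℕ.^ 2` computes to `n ℕ.* (n ℕ.* 1)`.
      ≡⟨ cong₂ (λ e L → (P∞ · (q^ e · (1/ qPoch L))) i)
           (cong (λ z → n ℕ.* z ℕ.+ n) (≡.sym (ℕ.*-identityʳ n))) (L≡ n) ⟩
    (P∞ · lhsTerm n) i ∎
    where
    open ≡.≡-Reasoning
    e = n ℕ.* n ℕ.+ n
    p = 1/qPoch (+ suc (n ℕ.+ n))
    p′ = 1/qPoch (+ a ℤ.- + n)
    L≡ : ∀ n → 1 ℕ.+ (n ℕ.+ n) ≡ 2 ℕ.* n ℕ.+ 1
    L≡ = ℕ-Solver.solve-∀
    n≤D : e ℕ.≤ N → ∣ ℤ.- + n ∣ ℕ.≤ D
    n≤D e≤N = ℕ.≤-trans (ℕ.≤-reflexive (ℤ.∣-i∣≡∣i∣ (+ n))) (ℕ.≤-trans (ℕ.m≤n+m n (n ℕ.* n))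
      (ℕ.≤-trans e≤N (ℕ.≤-trans (ℕ.m≤n*m N 3) (ℕ.m≤m+n (3 ℕ.* N) 2))))

  L R T₁ T₂ : FPS
  L = ∑ lhsTerm lhs-summable
  R = ∑ rhsTerm rhs-summable
  T₁ = ∑± K (λ k → q^ ∣ e₁ k ∣)
  T₂ = ∑± K (λ k → q^ ∣ e₂ k ∣)

  T₁≈R+T₂ : T₁ ≈[ N ] R ⊕ T₂
  T₁≈R+T₂ i i≤N = begin
    T₁ i
      ≡⟨ ∑±-cong K (λ k n → eq ((q^ ∣ e₁ k ∣) n) ((q^ ∣ e₂ k ∣) n)) i ⟩
    ∑± K (λ k → rhsTerm k ⊕ q^ ∣ e₂ k ∣) i      ≡⟨ ∑±-+ K rhsTerm (λ k → q^ ∣ e₂ k ∣) i ⟩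
    ∑± K rhsTerm i ℤ.+ T₂ i                     ≡⟨ cong (ℤ._+ T₂ i) (∑-rhs N<K i i≤N) ⟨
    R i ℤ.+ T₂ i                                ∎
    where
    open ≡.≡-Reasoning
    eq : ∀ x y → x ≡ x ℤ.- y ℤ.+ y
    eq = solve-∀

  -- Neither side involves a, although a is chosen from N; letting N vary therefore gives an
  -- identity of series, ready for `cancel-unit`.
  limit : (R · (P∞ · P∞)) N ≡ (L · P∞) N
  -- Both sides gain `P² · T₂` because `finite-identity` keeps its negative terms on the other side.
  limit = +-cancelʳ ((P² · T₂) N) _ _ (begin
    (R · P²) N ℤ.+ (P² · T₂) N
      ≡⟨ solve 3 (λ r p t → r :* p :+ p :* t := p :* (r :+ t)) (λ _ → ≡.refl) R P² T₂ N ⟩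
    (P² · (R ⊕ T₂)) N
      ≡⟨ ·-cong-mod {N} {P²} {P²} {T₁} {R ⊕ T₂} (λ _ _ → ≡.refl) T₁≈R+T₂ N ℕ.≤-refl ⟨
    (P² · T₁) N
      ≡⟨ ∑±-*ˡ K P² (λ k → q^ ∣ e₁ k ∣) N ⟩
    ∑± K (λ k → P² · q^ ∣ e₁ k ∣) N
      ≡⟨ ∑±-cong-mod N K theta₁-limit N ℕ.≤-refl ⟨
    ∑± K (theta₁ a) N
      ≡⟨ finite-identity a N ⟩
    ∑± K (theta₂ a) N ℤ.+ ∑< K (λ n → bailey a (1/qPoch (+ suc (n ℕ.+ n))) n) N
      ≡⟨ cong₂ ℤ._+_ (∑±-cong-mod N K theta₂-limit N ℕ.≤-refl)
          (∑<-cong-mod N K bailey-limit N ℕ.≤-refl) ⟩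
    ∑± K (λ k → P² · q^ ∣ e₂ k ∣) N ℤ.+ ∑< K (λ n → P∞ · lhsTerm n) N
      ≡⟨ cong₂ ℤ._+_ (∑±-*ˡ K P² (λ k → q^ ∣ e₂ k ∣) N) (∑<-*ˡ K P∞ lhsTerm N) ⟨
    (P² · T₂) N ℤ.+ (P∞ · ∑< K lhsTerm) N
      ≡⟨ cong (λ z → (P² · T₂) N ℤ.+ z) (·-cong-mod {N} {P∞} {P∞} {L} {∑< K lhsTerm}
          (λ _ _ → ≡.refl) (∑-lhs N<K) N ℕ.≤-refl) ⟨
    (P² · T₂) N ℤ.+ (P∞ · L) N
      ≡⟨ solve 3 (λ p t l → t :+ p :* l := l :* p :+ t) (λ _ → ≡.refl) P∞ (P² · T₂) L N ⟩
    (L · P∞) N ℤ.+ (P² · T₂) N ∎)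
    where
    open ≡.≡-Reasoning
    P² = P∞ · P∞

open import Data.Integer.Base using (_+_; _*_; _-_)

corollary5p2 : ∑ {ℕ} (λ n → q^ (n ℕ.^ 2 ℕ.+ n) / qPoch (2 ℕ.* n ℕ.+ 1)) lhs-summable
    ≈
    1/ qPoch∞ · ∑ {ℤ} (λ k → q^ ∣ + 15 * (k * k) - + 4 * k ∣ ⊖ q^ ∣ + 15 * (k * k) + + 14 * k + + 3 ∣) rhs-summable
corollary5p2 = cancel-unit {qPoch∞} {P∞} {∑ lhsTerm lhs-summable} {∑ rhsTerm rhs-summable}
  qPoch∞-inverse Limit.limit
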